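{- Let $m\geq 3$ be an integer, let $G$ be a bicyclic graph on $2m$ vertices with matching number $m$ (i.e. $G$ has a perfect matching), and let $D$ be any orientation of $G$. Then $$M_1(D)\leq \frac{1}{2}(m^2+9m+2),$$ with equality if and only if $D$ is isomorphic to $B^{(1)}_{2m,m}$ or to $B^{(2)}_{2m,m}$.
   Context: All graphs are finite and simple. A bicyclic graph is a connected graph with $|E|=|V|+1$. The matching number of a graph is the maximum number of pairwise disjoint edges. An orientation $D$ of a graph $G$ is obtained by replacing each edge $uv$ by exactly one of the arcs $uv$ or $vu$. For a vertex $u$ of $D$, $d^+_u$ and $d^-_u$ denote its out-degree and in-degree. The first Zagreb index of a digraph $D=(V,A)$ is $M_1(D)=\frac{1}{2}\sum_{uv\in A}(d^+_u+d^-_v)$. $B_{2m,m}$ is the bicyclic graph on $2m$ vertices obtained from two triangles sharing exactly one common vertex $c$ by attaching one pendent edge and $m-3$ paths of length two at $c$. The orientation $B^{(1)}_{2m,m}$: every edge incident with $c$ is oriented away from $c$; for each attached path $c\,a\,b$ the edge $ab$ is oriented from $b$ to $a$; in each triangle $c\,x\,y$ the edge $xy$ is oriented in either direction (both choices give isomorphic digraphs). $B^{(2)}_{2m,m}$ is obtained from $B^{(1)}_{2m,m}$ by reversing every arc. -}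

module Defs where

open import Data.Nat using (ℕ; zero; suc; _+_; _*_; _∸_; _≤_; _≡ᵇ_; _<ᵇ_; _%_)
open import Data.Bool using (Bool; true; false; _∧_; _∨_; if_then_else_; not)
open import Data.Fin using (Fin; toℕ)
open import Data.Nat.ListAction using (sum)
open import Data.List using (List; []; _∷_; map; concatMap; allFin; length)
open import Data.List.Relation.Unary.All using (All)
open import Data.List.Relation.Unary.Unique.Propositional using (Unique)
open import Data.Product using (_×_; _,_; Σ; ∃)
open import Function.Bundles using (_↔_; Inverse)
open import Relation.Binary.PropositionalEquality using (_≡_)

record Graph (n : ℕ) : Set where
  field
    adj   : Fin n → Fin n → Bool
    sym   : ∀ u v → adj u v ≡ adj v u
    irrefl : ∀ u → adj u u ≡ false
open Graph public

𝟙 : Bool → ℕ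
𝟙 b = if b then 1 else 0

sumPairs : ∀ {n} → (Fin n → Fin n → ℕ) → ℕ
sumPairs {n} f = sum (concatMap (λ u → map (λ v → f u v) (allFin n)) (allFin n))

edgeCount : ∀ {n} → Graph n → ℕ
edgeCount G = sumPairs (λ u v → 𝟙 (adj G u v ∧ (toℕ u <ᵇ toℕ v)))

data Reach {n} (G : Graph n) (u : Fin n) : Fin n → Set where
  here : Reach G u u
  step : ∀ {v w} → Reach G u v → adj G v w ≡ true → Reach G u w

Connected : ∀ {n} → Graph n → Set
Connected {n} G = ∀ (u v : Fin n) → Reach G u v

Bicyclic : ∀ {n} → Graph n → Set
Bicyclic {n} G = Connected G × (edgeCount G ≡ n + 1)

endpoints : ∀ {n} → List (Fin n × Fin n) → List (Fin n)
endpoints = concatMap (λ { (u , v) → u ∷ v ∷ [] })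

IsMatching : ∀ {n} → Graph n → List (Fin n × Fin n) → Set
IsMatching G M = All (λ { (u , v) → adj G u v ≡ true }) M × Unique (endpoints M)

MatchingNumber : ∀ {n} → Graph n → ℕ → Set
MatchingNumber {n} G k =
  (Σ (List (Fin n × Fin n)) λ M → IsMatching G M × length M ≡ k)
  × (∀ M → IsMatching G M → length M ≤ k)

Digraph : ℕ → Set
Digraph n = Fin n → Fin n → Bool

IsOrientation : ∀ {n} → Graph n → Digraph n → Set
IsOrientation {n} G D =
  ∀ (u v : Fin n) → ((D u v ∨ D v u) ≡ adj G u v) × ((D u v ∧ D v u) ≡ false)

outdeg : ∀ {n} → Digraph n → Fin n → ℕ
outdeg {n} D u = sum (map (λ v → 𝟙 (D u v)) (allFin n))

indeg : ∀ {n} → Digraph n → Fin n → ℕ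
indeg {n} D v = sum (map (λ u → 𝟙 (D u v)) (allFin n))

twiceM₁ : ∀ {n} → Digraph n → ℕ
twiceM₁ D = sumPairs (λ u v → if D u v then outdeg D u + indeg D v else 0)

_≅_ : ∀ {n} → Digraph n → Digraph n → Set
_≅_ {n} D E = Σ (Fin n ↔ Fin n) λ f →
  ∀ (u v : Fin n) → D u v ≡ E (Inverse.to f u) (Inverse.to f v)

-- B^{(1)}_{2m,m} on vertex set {0,…,2m-1}:
--   c = 0; triangles c,1,2 and c,3,4; pendant vertex 5;
--   paths c a_i b_i with a_i = 6+2i, b_i = 7+2i (i = 0,…,m-4).
-- Arcs: 0→v for v ∈ {1,…,5} and v even ≥ 6; 1→2; 3→4; b→b-1 for b odd ≥ 7.

B1arcℕ : ℕ → ℕ → Bool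
B1arcℕ u v =
     ((u ≡ᵇ 0) ∧ ((0 <ᵇ v) ∧ (v <ᵇ 6) ∨ ((5 <ᵇ v) ∧ (v % 2 ≡ᵇ 0))))
  ∨ ((u ≡ᵇ 1) ∧ (v ≡ᵇ 2))
  ∨ ((u ≡ᵇ 3) ∧ (v ≡ᵇ 4))
  ∨ ((6 <ᵇ u) ∧ (u % 2 ≡ᵇ 1) ∧ (v ≡ᵇ u ∸ 1))

B1 : (m : ℕ) → Digraph (2 * m)
B1 m u v = B1arcℕ (toℕ u) (toℕ v)

B2 : (m : ℕ) → Digraph (2 * m)
B2 m u v = B1 m v u

{-# OPTIONS --safe #-}
module Submission where

-- Split the 2m + 1 arcs of D into the m arcs of the perfect matching M and the remaining m + 1 arcs N. Twice the
-- Zagreb index counts, over all ordered pairs of arcs, the common tails and the common heads, which gives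
--   twiceM₁ D = m² + 9m + 6 − 2 (P + Q),
-- where P is the number of unordered pairs in N with neither a common tail nor a common head (half of `conflict N`),
-- and Q (`misfit M N`) is the number of times a tail of N is a head of M or a head of N is a tail of M.
-- If P = 0 then N is a star, say with all arcs leaving c. When c is a head of M, Q ≥ m + 1. Otherwise the arcs of N
-- ending in heads of M miss the partner of c, so there are at most m − 1 of them and Q ≥ 2, with equality exactly for
-- B⁽¹⁾. If P > 0, then P ≥ 2, and P ≥ 3 when m ≥ 4. For m = 3 and Q = 0, N consists of four off-diagonal cells of a
-- 3 × 3 board, again giving P ≥ 3. So P + Q ≥ 3 whenever P > 0.

open import Defs hiding (sym)
open import Data.Bool using (Bool; true; false; if_then_else_; _∧_; _∨_; T)
import Data.Bool.Properties as Bool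
open import Data.Empty using (⊥; ⊥-elim)
open import Data.Fin using (Fin; zero; suc; toℕ; fromℕ<; #_)
import Data.Fin.Properties as Fin
open import Data.List using (List; []; _∷_; _++_; map; length; filter; concatMap; cartesianProduct; allFin; lookup)
import Data.List.Membership.DecPropositional as DecMembership
open import Data.List.Membership.Propositional using (_∈_; _∉_)
open import Data.List.Membership.Propositional.Properties using (∈-∃++; ∈-++⁺ˡ; ∈-++⁺ʳ; ∈-++⁻; ∈-map⁺; ∈-map⁻; ∈-filter⁺; ∈-filter⁻; ∈-cartesianProduct⁺; ∈-allFin; ∈-lookup)
open import Data.List.Properties using (++-identityʳ; length-++; length-map; length-tabulate; map-++; map-∘; map-cong; map-cong-local; ∷-injectiveˡ; ∷-injectiveʳ)
open import Data.List.Relation.Binary.Permutation.Propositional as Perm using (_↭_; ↭-refl; ↭-sym; ↭-trans; ↭-reflexive; prep; ↭⇒↭ₛ)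
open import Data.List.Relation.Binary.Permutation.Propositional.Properties using (shift; ↭-length; ∈-resp-↭; map⁺; ++⁺; drop-∷)
import Data.List.Relation.Binary.Permutation.Setoid.Properties as Permₛ
open import Data.List.Relation.Unary.All as All using (All; []; _∷_)
open import Data.List.Relation.Unary.AllPairs using ([]; _∷_)
open import Data.List.Relation.Unary.Any using (here; there; index)
open import Data.List.Relation.Unary.Any.Properties using (lookup-index)
open import Data.List.Relation.Unary.Unique.DecPropositional using (unique?)
open import Data.List.Relation.Unary.Unique.Propositional using (Unique)
import Data.List.Relation.Unary.Unique.Propositional.Properties as Unique
open import Data.Nat using (ℕ; zero; suc; _+_; _*_; _∸_; _≤_; _<_; _<ᵇ_; _≡ᵇ_; _≤?_; _%_; z≤n; s≤s)
open import Data.Nat.DivMod using (m*n%n≡0; [m+kn]%n≡m%n)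
open import Data.Nat.ListAction using (sum)
open import Data.Nat.ListAction.Properties using (sum-++; sum-↭)
open import Data.Nat.Properties
open import Data.Nat.Solver using (module +-*-Solver)
open import Data.Product as Product using (_×_; _,_; proj₁; proj₂; ∃-syntax; swap)
open import Data.Product.Properties using (≡-dec)
open import Data.Sum as Sum using (_⊎_; inj₁; inj₂)
open import Function using (_∘_; id; flip)
open import Function.Bundles using (_⇔_; mk⇔; mk↔ₛ′; Inverse)
open import Relation.Binary.Definitions using (tri<; tri≈; tri>)
open import Relation.Binary.PropositionalEquality using (_≡_; _≢_; refl; sym; trans; cong; cong₂; subst; subst₂; setoid; module ≡-Reasoning)
open import Relation.Nullary using (¬_; yes; no; does; _→-dec_; ¬?)
open import Relation.Nullary.Decidable using (from-yes)
open import Relation.Unary using (Decidable)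

-- Sums over lists

-- Read an arc as a cell of a board whose rows are the possible tails and whose columns are the
-- possible heads: two distinct arcs contribute to the index exactly when their cells lie in one row
-- or one column. Arcs that pairwise contribute therefore fill part of a single row or column, which
-- is the star. Two cells that are not in line have only two cells in line with both, the other
-- corners of their rectangle, and these are not in line with each other. So one conflict forces
-- more: any two further arcs cost one, any three cost two. For m = 3 only two further arcs exist
-- and the count stops at P = 2. The missing unit comes from Q or from the board: the cells of M
-- form its diagonal, so N contains neither three cells of a line nor a full rectangle. Equality is
-- handled through `Spider`, a description of B⁽¹⁾ by an ordered list of matching arcs. It pulls
-- back along isomorphisms, so the value is computed in `D` itself. Stars with a common head reduce
-- to stars with a common tail by reversing all arcs.

∑ : {A : Set} → List A → (A → ℕ) → ℕ
∑ xs f = sum (map f xs)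

infixr 5 ∑
syntax ∑ xs (λ x → e) = ∑[ x ∈ xs ] e

module _ {A : Set} where

  ∑-cong-∈ : {f g : A → ℕ} (xs : List A) → (∀ {x} → x ∈ xs → f x ≡ g x) → ∑ xs f ≡ ∑ xs g
  ∑-cong-∈ []       eq = refl
  ∑-cong-∈ (x ∷ xs) eq = cong₂ _+_ (eq (here refl)) (∑-cong-∈ xs (eq ∘ there))

  ∑-cong : {f g : A → ℕ} (xs : List A) → (∀ x → f x ≡ g x) → ∑ xs f ≡ ∑ xs g
  ∑-cong xs eq = cong sum (map-cong eq xs)

  ∑-mono-∈ : {f g : A → ℕ} (xs : List A) → (∀ {x} → x ∈ xs → f x ≤ g x) → ∑ xs f ≤ ∑ xs g
  ∑-mono-∈ []       le = z≤n
  ∑-mono-∈ (x ∷ xs) le = +-mono-≤ (le (here refl)) (∑-mono-∈ xs (le ∘ there))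

  ∑-+ : (f g : A → ℕ) (xs : List A) → ∑ xs (λ x → f x + g x) ≡ ∑ xs f + ∑ xs g
  ∑-+ f g []       = refl
  ∑-+ f g (x ∷ xs) = trans (cong (f x + g x +_) (∑-+ f g xs))
    (solve 4 (λ a b c d → (a :+ b) :+ (c :+ d) := (a :+ c) :+ (b :+ d)) refl (f x) (g x) (∑ xs f) (∑ xs g))
    where open +-*-Solver

  ∑-const : (c : ℕ) (xs : List A) → ∑ xs (λ _ → c) ≡ length xs * c
  ∑-const c []       = refl
  ∑-const c (x ∷ xs) = cong (c +_) (∑-const c xs)

  ∑-zero : {f : A → ℕ} (xs : List A) → (∀ {x} → x ∈ xs → f x ≡ 0) → ∑ xs f ≡ 0
  ∑-zero []       eq = refl
  ∑-zero (x ∷ xs) eq = cong₂ _+_ (eq (here refl)) (∑-zero xs (eq ∘ there))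

  ∑-*ʳ : (f : A → ℕ) (c : ℕ) (xs : List A) → ∑ xs (λ x → f x * c) ≡ ∑ xs f * c
  ∑-*ʳ f c []       = refl
  ∑-*ʳ f c (x ∷ xs) = trans (cong (f x * c +_) (∑-*ʳ f c xs)) (sym (*-distribʳ-+ c (f x) (∑ xs f)))

  ∑-++ : (f : A → ℕ) (xs ys : List A) → ∑ (xs ++ ys) f ≡ ∑ xs f + ∑ ys f
  ∑-++ f xs ys = trans (cong sum (map-++ f xs ys)) (sum-++ (map f xs) (map f ys))

  ∑-↭ : (f : A → ℕ) {xs ys : List A} → xs ↭ ys → ∑ xs f ≡ ∑ ys f
  ∑-↭ f p = sum-↭ (map⁺ f p)

  ∑-member-≤ : (f : A → ℕ) {x : A} {xs : List A} → x ∈ xs → f x ≤ ∑ xs f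
  ∑-member-≤ f {xs = y ∷ ys} (here refl) = m≤m+n _ _
  ∑-member-≤ f {xs = y ∷ ys} (there i)   = ≤-trans (∑-member-≤ f i) (m≤n+m _ (f y))

  ∑-positive : (f : A → ℕ) (xs : List A) {k : ℕ} → ∑ xs f ≡ suc k → ∃[ x ] x ∈ xs × ∃[ j ] f x ≡ suc j
  ∑-positive f (x ∷ xs) eq with f x in fx
  ... | suc j = x , here refl , j , fx
  ... | zero with ∑-positive f xs eq
  ...   | y , i , r = y , there i , r

  ∑-filter : {P : A → Set} (P? : Decidable P) (f : A → ℕ) (xs : List A) →
             ∑ (filter P? xs) f ≡ ∑[ x ∈ xs ] (if does (P? x) then f x else 0)
  ∑-filter P? f []       = refl
  ∑-filter P? f (x ∷ xs) with does (P? x)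
  ... | true  = cong (f x +_) (∑-filter P? f xs)
  ... | false = ∑-filter P? f xs

∑-map : {A B : Set} (f : B → ℕ) (g : A → B) (xs : List A) → ∑ (map g xs) f ≡ ∑ xs (f ∘ g)
∑-map f g xs = cong sum (sym (map-∘ xs))

module _ {A B : Set} where

  ∑-swap : (f : A → B → ℕ) (xs : List A) (ys : List B) →
           (∑[ x ∈ xs ] ∑[ y ∈ ys ] f x y) ≡ (∑[ y ∈ ys ] ∑[ x ∈ xs ] f x y)
  ∑-swap f []       ys = sym (∑-zero ys λ _ → refl)
  ∑-swap f (x ∷ xs) ys = trans (cong (∑ ys (f x) +_) (∑-swap f xs ys))
                               (sym (∑-+ (f x) (λ y → ∑ xs (λ z → f z y)) ys))

  ∑-cartesianProduct : (f : A × B → ℕ) (xs : List A) (ys : List B) →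
                       ∑ (cartesianProduct xs ys) f ≡ (∑[ x ∈ xs ] ∑[ y ∈ ys ] f (x , y))
  ∑-cartesianProduct f []       ys = refl
  ∑-cartesianProduct f (x ∷ xs) ys =
    trans (∑-++ f (map (x ,_) ys) (cartesianProduct xs ys))
          (cong₂ _+_ (∑-map f (x ,_) ys) (∑-cartesianProduct f xs ys))

  sum-concatMap : (f : A → B → ℕ) (xs : List A) (ys : List B) →
                  sum (concatMap (λ x → map (f x) ys) xs) ≡ (∑[ x ∈ xs ] ∑[ y ∈ ys ] f x y)
  sum-concatMap f []       ys = refl
  sum-concatMap f (x ∷ xs) ys = trans (sum-++ (map (f x) ys) _) (cong (∑ ys (f x) +_) (sum-concatMap f xs ys))

-- Duplicate-free lists

module _ {A : Set} where

  Unique-resp-↭ : {xs ys : List A} → xs ↭ ys → Unique xs → Unique ys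
  Unique-resp-↭ p = Permₛ.Unique-resp-↭ (setoid A) (↭⇒↭ₛ p)

  unique-++ˡ : (xs : List A) {ys : List A} → Unique (xs ++ ys) → Unique xs
  unique-++ˡ []       u       = []
  unique-++ˡ (x ∷ xs) (a ∷ u) = All.tabulate (λ i → All.lookup a (∈-++⁺ˡ i)) ∷ unique-++ˡ xs u

  unique-++ʳ : (xs : List A) {ys : List A} → Unique (xs ++ ys) → Unique ys
  unique-++ʳ []       u       = u
  unique-++ʳ (x ∷ xs) (_ ∷ u) = unique-++ʳ xs u

  unique-++-disjoint : (xs : List A) {ys : List A} → Unique (xs ++ ys) → ∀ {x} → x ∈ xs → x ∉ ys
  unique-++-disjoint (x ∷ xs) (a ∷ u) (here refl) j = All.lookup a (∈-++⁺ʳ xs j) refl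
  unique-++-disjoint (x ∷ xs) (a ∷ u) (there i)   j = unique-++-disjoint xs u i j

  -- Complements of sublists up to order. The remainder `zs` supplies the non-matching arcs `N`, the
  -- leg arcs `R` of a spider, and the slack in every counting bound below.
  unique⊆⇒↭ : {xs ys : List A} → Unique xs → (∀ {x} → x ∈ xs → x ∈ ys) → ∃[ zs ] ys ↭ xs ++ zs
  unique⊆⇒↭ {[]}     {ys} _       _  = ys , ↭-refl
  unique⊆⇒↭ {x ∷ xs} {ys} (a ∷ u) xs⊆ys with ∈-∃++ (xs⊆ys (here refl))
  ... | as , bs , refl = proj₁ rec , ↭-trans (shift x as bs) (prep x (proj₂ rec))
    where
    drop-x : ∀ {y} → y ∈ as ++ x ∷ bs → x ≢ y → y ∈ as ++ bs
    drop-x i x≢y with ∈-resp-↭ (shift x as bs) i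
    ... | here refl = ⊥-elim (x≢y refl)
    ... | there j   = j
    rec = unique⊆⇒↭ u λ i → drop-x (xs⊆ys (there i)) (All.lookup a i)

  unique⊆⇒length≤ : {xs ys : List A} → Unique xs → (∀ {x} → x ∈ xs → x ∈ ys) → length xs ≤ length ys
  unique⊆⇒length≤ {xs} {ys} u xs⊆ys with unique⊆⇒↭ u xs⊆ys
  ... | zs , p = ≤-trans (m≤m+n _ _) (≤-reflexive (sym (trans (↭-length p) (length-++ xs))))

  -- The remainder has length zero. Uniqueness of `ys` is then a consequence, which is how the
  -- endpoints of the concrete matching of `B1` are shown to be distinct.
  unique⊆∧length⇒↭ : {xs ys : List A} → Unique xs → (∀ {x} → x ∈ xs → x ∈ ys) →
                     length ys ≤ length xs → ys ↭ xs
  unique⊆∧length⇒↭ {xs} {ys} u xs⊆ys le with unique⊆⇒↭ u xs⊆ys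
  ... | [] , p     = ↭-trans p (↭-reflexive (++-identityʳ xs))
  ... | z ∷ zs , p = ⊥-elim (1+k≰0 (+-cancelʳ-≤ _ _ 0 (≤-trans (≤-reflexive
                        (trans (+-comm (length (z ∷ zs)) (length xs)) (sym (trans (↭-length p) (length-++ xs))))) le)))
    where
    1+k≰0 : ∀ {k} → suc k ≤ 0 → ⊥
    1+k≰0 ()

  unique⊆⊇⇒↭ : {xs ys : List A} → Unique xs → Unique ys →
               (∀ {x} → x ∈ xs → x ∈ ys) → (∀ {x} → x ∈ ys → x ∈ xs) → xs ↭ ys
  unique⊆⊇⇒↭ u v xs⊆ys ys⊆xs = unique⊆∧length⇒↭ v ys⊆xs (unique⊆⇒length≤ u xs⊆ys)

  filter-split : {P : A → Set} (P? : Decidable P) (xs : List A) →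
                 ∃[ ys ] xs ↭ filter P? xs ++ ys × (∀ {x} → x ∈ ys → x ∈ xs × (P x → ⊥))
  filter-split P? [] = [] , ↭-refl , λ ()
  filter-split P? (x ∷ xs) with P? x | filter-split P? xs
  ... | yes _  | ys , p , no-P = ys , prep x p , λ i → there (proj₁ (no-P i)) , proj₂ (no-P i)
  ... | no ¬Px | ys , p , no-P = x ∷ ys , ↭-trans (prep x p) (↭-sym (shift x _ ys)) , λ
    { (here refl) → here refl , ¬Px
    ; (there i)   → there (proj₁ (no-P i)) , proj₂ (no-P i) }

-- Counting occurrences

δ : {n : ℕ} → Fin n → Fin n → ℕ
δ u v = 𝟙 (does (u Fin.≟ v))

module _ {n : ℕ} where

  δ-refl : (u : Fin n) → δ u u ≡ 1
  δ-refl u with u Fin.≟ u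
  ... | yes _  = refl
  ... | no u≢u = ⊥-elim (u≢u refl)

  δ-≢ : {u v : Fin n} → u ≢ v → δ u v ≡ 0
  δ-≢ {u} {v} u≢v with u Fin.≟ v
  ... | yes eq = ⊥-elim (u≢v eq)
  ... | no _   = refl

  δ-sym : (u v : Fin n) → δ u v ≡ δ v u
  δ-sym u v with u Fin.≟ v
  ... | yes refl = sym (δ-refl u)
  ... | no u≢v   = sym (δ-≢ (u≢v ∘ sym))

  ∑-δ : (h : Fin n → ℕ) {v : Fin n} {xs : List (Fin n)} → Unique xs → v ∈ xs → (∑[ x ∈ xs ] δ v x * h x) ≡ h v
  ∑-δ h {v} {x ∷ xs} (a ∷ u) (here refl) = begin
    δ v v * h v + (∑[ x ∈ xs ] δ v x * h x)
      ≡⟨ cong₂ _+_ (cong (_* h v) (δ-refl v)) (∑-zero xs λ {x} i → cong (_* h x) (δ-≢ (All.lookup a i))) ⟩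
    1 * h v + 0
      ≡⟨ trans (+-identityʳ _) (*-identityˡ (h v)) ⟩
    h v ∎
    where open ≡-Reasoning
  ∑-δ h {v} {x ∷ xs} (a ∷ u) (there i) =
    cong₂ _+_ (cong (_* h x) (δ-≢ (All.lookup a i ∘ sym))) (∑-δ h u i)

-- Arc lists

Arc : ℕ → Set
Arc n = Fin n × Fin n

module _ {n : ℕ} where

  arcs : Digraph n → List (Arc n)
  arcs D = filter (λ e → D (proj₁ e) (proj₂ e) Bool.≟ true) (cartesianProduct (allFin n) (allFin n))

  arcs-unique : (D : Digraph n) → Unique (arcs D)
  arcs-unique D = Unique.filter⁺ _ (Unique.cartesianProduct⁺ (Unique.allFin⁺ n) (Unique.allFin⁺ n))

  ∈-arcs⁺ : (D : Digraph n) {u v : Fin n} → D u v ≡ true → (u , v) ∈ arcs D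
  ∈-arcs⁺ D {u} {v} = ∈-filter⁺ _ (∈-cartesianProduct⁺ (∈-allFin u) (∈-allFin v))

  ∈-arcs⁻ : (D : Digraph n) {u v : Fin n} → (u , v) ∈ arcs D → D u v ≡ true
  ∈-arcs⁻ D = proj₂ ∘ ∈-filter⁻ _ {xs = cartesianProduct (allFin n) (allFin n)}

  sumPairs≡∑ : (f : Fin n → Fin n → ℕ) → sumPairs f ≡ (∑[ u ∈ allFin n ] ∑[ v ∈ allFin n ] f u v)
  sumPairs≡∑ f = sum-concatMap f (allFin n) (allFin n)

  ∑-arcs : (D : Digraph n) (g : Arc n → ℕ) →
           ∑ (arcs D) g ≡ (∑[ u ∈ allFin n ] ∑[ v ∈ allFin n ] (if D u v then g (u , v) else 0))
  ∑-arcs D g = begin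
    ∑ (arcs D) g
      ≡⟨ ∑-filter _ g (cartesianProduct (allFin n) (allFin n)) ⟩
    ∑ (cartesianProduct (allFin n) (allFin n)) _
      ≡⟨ ∑-cartesianProduct _ (allFin n) (allFin n) ⟩
    _
      ≡⟨ ∑-cong (allFin n) (λ u → ∑-cong (allFin n) λ v → cong (if_then g (u , v) else 0) (does-≟ (D u v))) ⟩
    (∑[ u ∈ allFin n ] ∑[ v ∈ allFin n ] (if D u v then g (u , v) else 0)) ∎
    where
    open ≡-Reasoning
    does-≟ : ∀ b → does (b Bool.≟ true) ≡ b
    does-≟ true  = refl
    does-≟ false = refl

  outdeg≡∑ : (D : Digraph n) (u : Fin n) → outdeg D u ≡ (∑[ f ∈ arcs D ] δ u (proj₁ f))
  outdeg≡∑ D u = sym (begin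
    (∑[ f ∈ arcs D ] δ u (proj₁ f))
      ≡⟨ ∑-arcs D _ ⟩
    (∑[ x ∈ allFin n ] ∑[ y ∈ allFin n ] (if D x y then δ u x else 0))
      ≡⟨ ∑-cong (allFin n) (λ x → ∑-cong (allFin n) λ y → if≡𝟙* (D x y) (δ u x)) ⟩
    (∑[ x ∈ allFin n ] ∑[ y ∈ allFin n ] 𝟙 (D x y) * δ u x)
      ≡⟨ ∑-cong (allFin n) (λ x → trans (∑-*ʳ _ (δ u x) (allFin n)) (*-comm (outdeg D x) (δ u x))) ⟩
    (∑[ x ∈ allFin n ] δ u x * outdeg D x)
      ≡⟨ ∑-δ (outdeg D) (Unique.allFin⁺ n) (∈-allFin u) ⟩
    outdeg D u ∎)
    where
    open ≡-Reasoning
    if≡𝟙* : ∀ b d → (if b then d else 0) ≡ 𝟙 b * d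
    if≡𝟙* true  d = sym (*-identityˡ d)
    if≡𝟙* false d = refl

  indeg≡∑ : (D : Digraph n) (v : Fin n) → indeg D v ≡ (∑[ f ∈ arcs D ] δ v (proj₂ f))
  indeg≡∑ D v = begin
    indeg D v
      ≡⟨ outdeg≡∑ (flip D) v ⟩
    (∑[ f ∈ arcs (flip D) ] δ v (proj₁ f))
      ≡⟨ ∑-arcs (flip D) _ ⟩
    (∑[ x ∈ allFin n ] ∑[ y ∈ allFin n ] (if D y x then δ v x else 0))
      ≡⟨ ∑-swap (λ x y → if D y x then δ v x else 0) (allFin n) (allFin n) ⟩
    (∑[ y ∈ allFin n ] ∑[ x ∈ allFin n ] (if D y x then δ v x else 0))
      ≡⟨ ∑-arcs D _ ⟨
    (∑[ f ∈ arcs D ] δ v (proj₂ f)) ∎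
    where open ≡-Reasoning

  common : Arc n → Arc n → ℕ
  common e f = δ (proj₁ e) (proj₁ f) + δ (proj₂ e) (proj₂ f)

  common-sym : (e f : Arc n) → common e f ≡ common f e
  common-sym e f = cong₂ _+_ (δ-sym (proj₁ e) (proj₁ f)) (δ-sym (proj₂ e) (proj₂ f))

  -- The out-degree at the tail of `e` counts the arcs with that tail, `e` itself among them, and
  -- likewise for the in-degree at its head.
  twiceM₁≡∑ : (D : Digraph n) → twiceM₁ D ≡ (∑[ e ∈ arcs D ] ∑[ f ∈ arcs D ] common e f)
  twiceM₁≡∑ D = begin
    twiceM₁ D
      ≡⟨ sumPairs≡∑ _ ⟩
    _
      ≡⟨ ∑-arcs D (λ e → outdeg D (proj₁ e) + indeg D (proj₂ e)) ⟨
    (∑[ e ∈ arcs D ] outdeg D (proj₁ e) + indeg D (proj₂ e))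
      ≡⟨ ∑-cong (arcs D) (λ e → trans (cong₂ _+_ (outdeg≡∑ D (proj₁ e)) (indeg≡∑ D (proj₂ e)))
                                      (sym (∑-+ _ _ (arcs D)))) ⟩
    (∑[ e ∈ arcs D ] ∑[ f ∈ arcs D ] common e f) ∎
    where open ≡-Reasoning

  twiceM₁-flip : (D : Digraph n) → twiceM₁ (flip D) ≡ twiceM₁ D
  twiceM₁-flip D = begin
    twiceM₁ (flip D)
      ≡⟨ sumPairs≡∑ _ ⟩
    (∑[ u ∈ allFin n ] ∑[ v ∈ allFin n ] (if D v u then indeg D u + outdeg D v else 0))
      ≡⟨ ∑-swap (λ u v → if D v u then indeg D u + outdeg D v else 0) (allFin n) (allFin n) ⟩
    (∑[ v ∈ allFin n ] ∑[ u ∈ allFin n ] (if D v u then indeg D u + outdeg D v else 0))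
      ≡⟨ ∑-cong (allFin n) (λ v → ∑-cong (allFin n) λ u →
           cong (if D v u then_else 0) (+-comm (indeg D u) (outdeg D v))) ⟩
    (∑[ v ∈ allFin n ] ∑[ u ∈ allFin n ] (if D v u then outdeg D v + indeg D u else 0))
      ≡⟨ sumPairs≡∑ _ ⟨
    twiceM₁ D ∎
    where open ≡-Reasoning

  Loopless : Digraph n → Set
  Loopless D = ∀ u → D u u ≡ false

  module _ (G : Graph n) (D : Digraph n) (or : IsOrientation G D) where

    flip-orientation : IsOrientation G (flip D)
    flip-orientation u v =
      trans (Bool.∨-comm (D v u) (D u v)) (proj₁ (or u v)) , trans (Bool.∧-comm (D v u) (D u v)) (proj₂ (or u v))

    orientation-loopless : Loopless D
    orientation-loopless u = trans (sym (Bool.∧-idem (D u u))) (proj₂ (or u u))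

    -- `edgeCount` sees an edge only from its smaller endpoint, whereas its arc may run upwards or
    -- downwards. Splitting the arcs by direction and transposing the downward sum makes the two
    -- counts agree term by term.
    length-arcs : length (arcs D) ≡ edgeCount G
    length-arcs = begin
      length (arcs D)
        ≡⟨ trans (sym (*-identityʳ _)) (sym (∑-const 1 (arcs D))) ⟩
      ∑ (arcs D) (λ _ → 1)
        ≡⟨ ∑-arcs D _ ⟩
      (∑[ u ∈ allFin n ] ∑[ v ∈ allFin n ] 𝟙 (D u v))
        ≡⟨ ∑-cong (allFin n) (λ u → ∑-cong (allFin n) λ v → by-order u v) ⟩
      (∑[ u ∈ allFin n ] ∑[ v ∈ allFin n ] up u v + down u v)
        ≡⟨ ∑∑-+ up down ⟩
      (∑[ u ∈ allFin n ] ∑[ v ∈ allFin n ] up u v) + (∑[ u ∈ allFin n ] ∑[ v ∈ allFin n ] down u v)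
        ≡⟨ cong ((∑[ u ∈ allFin n ] ∑[ v ∈ allFin n ] up u v) +_) (∑-swap down (allFin n) (allFin n)) ⟩
      (∑[ u ∈ allFin n ] ∑[ v ∈ allFin n ] up u v) + (∑[ v ∈ allFin n ] ∑[ u ∈ allFin n ] down u v)
        ≡⟨ ∑∑-+ up (flip down) ⟨
      (∑[ u ∈ allFin n ] ∑[ v ∈ allFin n ] up u v + down v u)
        ≡⟨ ∑-cong (allFin n) (λ u → ∑-cong (allFin n) λ v → sym (by-direction u v)) ⟩
      (∑[ u ∈ allFin n ] ∑[ v ∈ allFin n ] 𝟙 (adj G u v ∧ (toℕ u <ᵇ toℕ v)))
        ≡⟨ sumPairs≡∑ _ ⟨
      edgeCount G ∎
      where
      open ≡-Reasoning
      up down : Fin n → Fin n → ℕ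
      up   u v = 𝟙 (D u v ∧ (toℕ u <ᵇ toℕ v))
      down u v = 𝟙 (D u v ∧ (toℕ v <ᵇ toℕ u))

      ∑∑-+ : (f g : Fin n → Fin n → ℕ) →
             (∑[ u ∈ allFin n ] ∑[ v ∈ allFin n ] f u v + g u v) ≡
             (∑[ u ∈ allFin n ] ∑[ v ∈ allFin n ] f u v) + (∑[ u ∈ allFin n ] ∑[ v ∈ allFin n ] g u v)
      ∑∑-+ f g = trans (∑-cong (allFin n) λ u → ∑-+ (f u) (g u) (allFin n)) (∑-+ _ _ (allFin n))

      T⇒≡true : ∀ {b} → T b → b ≡ true
      T⇒≡true {true} _ = refl

      <⇒<ᵇ≡true : ∀ {i j} → i < j → (i <ᵇ j) ≡ true
      <⇒<ᵇ≡true = T⇒≡true ∘ <⇒<ᵇ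

      ≮⇒<ᵇ≡false : ∀ {i j} → ¬ i < j → (i <ᵇ j) ≡ false
      ≮⇒<ᵇ≡false {i} {j} i≮j with i <ᵇ j in eq
      ... | true  = ⊥-elim (i≮j (<ᵇ⇒< i j (subst T (sym eq) _)))
      ... | false = refl

      by-order : ∀ u v → 𝟙 (D u v) ≡ up u v + down u v
      by-order u v with D u v in Duv
      ... | false = refl
      ... | true with <-cmp (toℕ u) (toℕ v)
      ...   | tri< lt _ ¬gt rewrite <⇒<ᵇ≡true lt | ≮⇒<ᵇ≡false ¬gt = refl
      ...   | tri> ¬lt _ gt rewrite <⇒<ᵇ≡true gt | ≮⇒<ᵇ≡false ¬lt = refl
      ...   | tri≈ _ eq _ with trans (sym Duv) (trans (cong (λ w → D w v) (Fin.toℕ-injective eq)) (orientation-loopless v))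
      ...     | ()

      by-direction : ∀ u v → 𝟙 (adj G u v ∧ (toℕ u <ᵇ toℕ v)) ≡ up u v + down v u
      by-direction u v rewrite sym (proj₁ (or u v)) with D u v | D v u | proj₂ (or u v)
      ... | true  | false | _ = sym (+-identityʳ _)
      ... | false | true  | _ = refl
      ... | false | false | _ = refl
      ... | true  | true  | ()

-- Perfect matchings

tails heads : ∀ {n} → List (Arc n) → List (Fin n)
tails = map proj₁
heads = map proj₂

module _ {n : ℕ} where

  endpoints↭ : (M : List (Arc n)) → endpoints M ↭ tails M ++ heads M
  endpoints↭ []            = ↭-refl
  endpoints↭ ((u , v) ∷ M) = prep u (↭-trans (prep v (endpoints↭ M)) (↭-sym (shift v (tails M) (heads M))))

  endpoints-length : (M : List (Arc n)) → length (endpoints M) ≡ 2 * length M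
  endpoints-length []      = refl
  endpoints-length (e ∷ M) = trans (cong (2 +_) (endpoints-length M))
    (solve 1 (λ k → con 2 :+ con 2 :* k := con 2 :* (con 1 :+ k)) refl (length M))
    where open +-*-Solver

  module _ (M : List (Arc n)) (u : Unique (endpoints M)) where

    private
      ends : Unique (tails M ++ heads M)
      ends = Unique-resp-↭ (endpoints↭ M) u

    tails-unique : Unique (tails M)
    tails-unique = unique-++ˡ (tails M) ends

    heads-unique : Unique (heads M)
    heads-unique = unique-++ʳ (tails M) ends

    matching-unique : Unique M
    matching-unique = Unique.map⁻ tails-unique

  unique-length⇒covers : {xs : List (Fin n)} → Unique xs → length xs ≡ n → ∀ v → v ∈ xs
  unique-length⇒covers u eq v = ∈-resp-↭
    (unique⊆∧length⇒↭ u (λ {x} _ → ∈-allFin x) (≤-reflexive (trans (length-tabulate id) (sym eq)))) (∈-allFin v)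

  #tails #heads : List (Arc n) → Fin n → ℕ
  #tails M v = ∑[ f ∈ M ] δ v (proj₁ f)
  #heads M v = ∑[ f ∈ M ] δ v (proj₂ f)

  -- The truncation acts only on the diagonal, where `common e e` is 2: an arc is not in conflict
  -- with itself, so sums over all ordered pairs need no exception.
  apart : Arc n → Arc n → ℕ
  apart e f = 1 ∸ common e f

  conflict : List (Arc n) → ℕ
  conflict N = ∑[ e ∈ N ] ∑[ f ∈ N ] apart e f

  misfit : List (Arc n) → List (Arc n) → ℕ
  misfit M N = ∑[ e ∈ N ] #heads M (proj₁ e) + #tails M (proj₂ e)

  #tails+#heads : (M : List (Arc n)) → Unique (endpoints M) → ∀ {v} → v ∈ endpoints M → #tails M v + #heads M v ≡ 1
  #tails+#heads M u {v} v∈ = begin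
    #tails M v + #heads M v
      ≡⟨ cong₂ _+_ (∑-map (δ v) proj₁ M) (∑-map (δ v) proj₂ M) ⟨
    ∑ (tails M) (δ v) + ∑ (heads M) (δ v)
      ≡⟨ ∑-++ (δ v) (tails M) (heads M) ⟨
    ∑ (tails M ++ heads M) (δ v)
      ≡⟨ ∑-↭ (δ v) (endpoints↭ M) ⟨
    ∑ (endpoints M) (δ v)
      ≡⟨ ∑-cong (endpoints M) (λ x → sym (*-identityʳ (δ v x))) ⟩
    (∑[ x ∈ endpoints M ] δ v x * 1)
      ≡⟨ ∑-δ (λ _ → 1) u v∈ ⟩
    1 ∎
    where open ≡-Reasoning

  common+apart-≢ : {e f : Arc n} → e ≢ f → common e f + apart e f ≡ 1
  common+apart-≢ {e} {f} e≢f with proj₁ e Fin.≟ proj₁ f | proj₂ e Fin.≟ proj₂ f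
  ... | yes p | yes q = ⊥-elim (e≢f (cong₂ _,_ p q))
  ... | yes _ | no _  = refl
  ... | no _  | yes _ = refl
  ... | no _  | no _  = refl

  -- Every other arc of `N` contributes 1, being either in line with `e` or apart from it, and `e`
  -- itself contributes 2.
  common+apart : {N : List (Arc n)} → Unique N → ∀ {e} → e ∈ N →
                 (∑[ f ∈ N ] common e f + apart e f) ≡ suc (length N)
  common+apart {e ∷ N} (a ∷ u) (here refl) = trans
    (cong₂ _+_ same (∑-cong-∈ N λ i → common+apart-≢ (All.lookup a i)))
    (cong (2 +_) (trans (∑-const 1 N) (*-identityʳ _)))
    where
    same : common e e + apart e e ≡ 2
    same rewrite δ-refl (proj₁ e) | δ-refl (proj₂ e) = refl
  common+apart {g ∷ N} (a ∷ u) {e} (there i) =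
    cong₂ _+_ (common+apart-≢ (All.lookup a i ∘ sym)) (common+apart u i)

1≤a∧a+b≡1⇒a≡1 : ∀ {a b} → 1 ≤ a → a + b ≡ 1 → a ≡ 1
1≤a∧a+b≡1⇒a≡1 {suc zero} _ _ = refl

-- Common tails and heads across the splitting into M and N

record Split (m : ℕ) {n : ℕ} (D : Digraph n) (M : List (Arc n)) : Set where
  field
    N           : List (Arc n)
    ends-unique : Unique (endpoints M)
    covers      : ∀ v → v ∈ endpoints M
    arcs↭       : arcs D ↭ M ++ N
    length-M    : length M ≡ m
    length-N    : length N ≡ suc m
    loopless    : Loopless D

  M++N-unique : Unique (M ++ N)
  M++N-unique = Unique-resp-↭ arcs↭ (arcs-unique D)

  N-unique : Unique N
  N-unique = unique-++ʳ M M++N-unique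

  M-N-disjoint : ∀ {e} → e ∈ M → e ∉ N
  M-N-disjoint = unique-++-disjoint M M++N-unique

  #ends : ∀ v → #tails M v + #heads M v ≡ 1
  #ends v = #tails+#heads M ends-unique (covers v)

  common-M : (e : Arc n) → (∑[ f ∈ M ] common e f) ≡ #tails M (proj₁ e) + #heads M (proj₂ e)
  common-M e = ∑-+ (λ f → δ (proj₁ e) (proj₁ f)) (λ f → δ (proj₂ e) (proj₂ f)) M

  #tails-tail : ∀ {e} → e ∈ M → #tails M (proj₁ e) ≡ 1
  #tails-tail {e} i = 1≤a∧a+b≡1⇒a≡1
    (≤-trans (≤-reflexive (sym (δ-refl (proj₁ e)))) (∑-member-≤ (λ f → δ (proj₁ e) (proj₁ f)) i)) (#ends (proj₁ e))

  #heads-head : ∀ {e} → e ∈ M → #heads M (proj₂ e) ≡ 1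
  #heads-head {e} i = 1≤a∧a+b≡1⇒a≡1
    (≤-trans (≤-reflexive (sym (δ-refl (proj₂ e)))) (∑-member-≤ (λ f → δ (proj₂ e) (proj₂ f)) i))
    (trans (+-comm (#heads M (proj₂ e)) (#tails M (proj₂ e))) (#ends (proj₂ e)))

  -- Arcs of a matching meet no others of it, so each contributes only the 2 from itself.
  common-MM : (∑[ e ∈ M ] ∑[ f ∈ M ] common e f) ≡ m * 2
  common-MM = trans (∑-cong-∈ M λ {e} i → trans (common-M e) (cong₂ _+_ (#tails-tail i) (#heads-head i)))
                    (trans (∑-const 2 M) (cong (_* 2) length-M))

  -- Each end of an arc of `N` lies on exactly one matching arc. It counts as common if it plays the
  -- same role there and as a misfit if it plays the opposite one, so every arc of `N` accounts for
  -- 2.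
  common-NM : (∑[ e ∈ N ] ∑[ f ∈ M ] common e f) + misfit M N ≡ suc m * 2
  common-NM = begin
    (∑[ e ∈ N ] ∑[ f ∈ M ] common e f) + misfit M N
      ≡⟨ ∑-+ _ _ N ⟨
    (∑[ e ∈ N ] (∑[ f ∈ M ] common e f) + (#heads M (proj₁ e) + #tails M (proj₂ e)))
      ≡⟨ ∑-cong N (λ e → trans (cong (_+ (#heads M (proj₁ e) + #tails M (proj₂ e))) (common-M e)) (both e)) ⟩
    ∑ N (λ _ → 2)
      ≡⟨ trans (∑-const 2 N) (cong (_* 2) length-N) ⟩
    suc m * 2 ∎
    where
    open ≡-Reasoning
    both : ∀ e → #tails M (proj₁ e) + #heads M (proj₂ e) + (#heads M (proj₁ e) + #tails M (proj₂ e)) ≡ 2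
    both e = trans
      (solve 4 (λ a b c d → a :+ b :+ (c :+ d) := (a :+ c) :+ (d :+ b)) refl
        (#tails M (proj₁ e)) (#heads M (proj₂ e)) (#heads M (proj₁ e)) (#tails M (proj₂ e)))
      (cong₂ _+_ (#ends (proj₁ e)) (#ends (proj₂ e)))
      where open +-*-Solver

  common-NN : (∑[ e ∈ N ] ∑[ f ∈ N ] common e f) + conflict N ≡ suc m * suc (suc m)
  common-NN = begin
    (∑[ e ∈ N ] ∑[ f ∈ N ] common e f) + conflict N
      ≡⟨ ∑-+ _ _ N ⟨
    (∑[ e ∈ N ] ((∑[ f ∈ N ] common e f) + (∑[ f ∈ N ] apart e f)))
      ≡⟨ ∑-cong-∈ N (λ {e} i → trans (sym (∑-+ (common e) (apart e) N)) (common+apart N-unique i)) ⟩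
    ∑ N (λ _ → suc (length N))
      ≡⟨ ∑-const (suc (length N)) N ⟩
    length N * suc (length N)
      ≡⟨ cong (λ k → k * suc k) length-N ⟩
    suc m * suc (suc m) ∎
    where open ≡-Reasoning

  -- The double sum over `M ++ N` expands like a square, with the mixed term occurring twice: 2m + 2
  -- · 2(m + 1) + (m + 1)(m + 2) before the losses. The losses stand on the left, so no truncated
  -- subtraction arises.
  twiceM₁-defect : twiceM₁ D + (2 * misfit M N + conflict N) ≡ m * m + 9 * m + 6
  twiceM₁-defect = begin
    twiceM₁ D + (2 * misfit M N + conflict N)
      ≡⟨ cong (_+ (2 * misfit M N + conflict N)) total ⟩
    (MM + NM) + (NM + NN) + (2 * misfit M N + conflict N)
      ≡⟨ solve 5 (λ a b c q x → (a :+ b) :+ (b :+ c) :+ (con 2 :* q :+ x) := a :+ con 2 :* (b :+ q) :+ (c :+ x)) refl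
           MM NM NN (misfit M N) (conflict N) ⟩
    MM + 2 * (NM + misfit M N) + (NN + conflict N)
      ≡⟨ cong₂ _+_ (cong₂ (λ a b → a + 2 * b) common-MM common-NM) common-NN ⟩
    m * 2 + 2 * (suc m * 2) + suc m * suc (suc m)
      ≡⟨ solve 1 (λ k → k :* con 2 :+ con 2 :* ((con 1 :+ k) :* con 2) :+ (con 1 :+ k) :* (con 2 :+ k)
                        := k :* k :+ con 9 :* k :+ con 6) refl m ⟩
    m * m + 9 * m + 6 ∎
    where
    open ≡-Reasoning
    open +-*-Solver
    MM NM NN : ℕ
    MM = ∑[ e ∈ M ] ∑[ f ∈ M ] common e f
    NM = ∑[ e ∈ N ] ∑[ f ∈ M ] common e f
    NN = ∑[ e ∈ N ] ∑[ f ∈ N ] common e f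
    row : ∀ K → (∑[ e ∈ K ] ∑[ f ∈ M ++ N ] common e f)
              ≡ (∑[ e ∈ K ] ∑[ f ∈ M ] common e f) + (∑[ e ∈ K ] ∑[ f ∈ N ] common e f)
    row K = trans (∑-cong K λ e → ∑-++ (common e) M N) (∑-+ _ _ K)
    MN≡NM : (∑[ e ∈ M ] ∑[ f ∈ N ] common e f) ≡ NM
    MN≡NM = trans (∑-swap common M N) (∑-cong N λ e → ∑-cong M λ f → common-sym f e)
    total : twiceM₁ D ≡ (MM + NM) + (NM + NN)
    total = begin
      twiceM₁ D
        ≡⟨ twiceM₁≡∑ D ⟩
      (∑[ e ∈ arcs D ] ∑[ f ∈ arcs D ] common e f)
        ≡⟨ ∑-↭ _ arcs↭ ⟩
      (∑[ e ∈ M ++ N ] ∑[ f ∈ arcs D ] common e f)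
        ≡⟨ ∑-cong (M ++ N) (λ e → ∑-↭ (common e) arcs↭) ⟩
      (∑[ e ∈ M ++ N ] ∑[ f ∈ M ++ N ] common e f)
        ≡⟨ ∑-++ _ M N ⟩
      (∑[ e ∈ M ] ∑[ f ∈ M ++ N ] common e f) + (∑[ e ∈ N ] ∑[ f ∈ M ++ N ] common e f)
        ≡⟨ cong₂ _+_ (trans (row M) (cong (MM +_) MN≡NM)) (row N) ⟩
      (MM + NM) + (NM + NN) ∎

mkSplit : ∀ {m} {D : Digraph (2 * m)} (M : List (Arc (2 * m))) → Loopless D → length (arcs D) ≡ 2 * m + 1 →
          Unique (endpoints M) → length M ≡ m → (∀ {e} → e ∈ M → e ∈ arcs D) → Split m D M
mkSplit {m} {D} M loopless |arcs| u |M| M⊆arcs with unique⊆⇒↭ (matching-unique M u) M⊆arcs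
... | N , p = record
  { N = N ; ends-unique = u ; arcs↭ = p ; length-M = |M| ; loopless = loopless
  ; covers = unique-length⇒covers u (trans (endpoints-length M) (cong (2 *_) |M|))
  ; length-N = +-cancelˡ-≡ m _ _ (begin
      m + length N          ≡⟨ cong (_+ length N) |M| ⟨
      length M + length N   ≡⟨ length-++ M ⟨
      length (M ++ N)       ≡⟨ ↭-length p ⟨
      length (arcs D)       ≡⟨ |arcs| ⟩
      2 * m + 1             ≡⟨ solve 1 (λ k → con 2 :* k :+ con 1 := k :+ (con 1 :+ k)) refl m ⟩
      m + suc m ∎) }
  where
  open ≡-Reasoning
  open +-*-Solver

-- A matching of the graph may list an edge against the direction that `D` gives it.
orient : ∀ {n} → Digraph n → Arc n → Arc n
orient D (u , v) = if D u v then (u , v) else (v , u)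

module _ {n : ℕ} (D : Digraph n) where

  endpoints-orient : (M : List (Arc n)) → endpoints M ↭ endpoints (map (orient D) M)
  endpoints-orient [] = ↭-refl
  endpoints-orient ((u , v) ∷ M) with D u v
  ... | true  = prep u (prep v (endpoints-orient M))
  ... | false = Perm.swap u v (endpoints-orient M)

  orient-arc : (G : Graph n) → IsOrientation G D → ∀ {u v} → adj G u v ≡ true → orient D (u , v) ∈ arcs D
  orient-arc G or {u} {v} uv with D u v in Duv | D v u in Dvu | proj₁ (or u v)
  ... | true  | _     | _  = ∈-arcs⁺ D Duv
  ... | false | true  | _  = ∈-arcs⁺ D Dvu
  ... | false | false | eq with trans eq uv
  ...   | ()

-- Conflicts

lookup-injective : {A : Set} {xs : List A} → Unique xs → ∀ i j → lookup xs i ≡ lookup xs j → i ≡ j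
lookup-injective {xs = x ∷ xs} _       zero    zero    _  = refl
lookup-injective {xs = x ∷ xs} (a ∷ _) zero    (suc j) eq = ⊥-elim (All.lookup a (∈-lookup j) eq)
lookup-injective {xs = x ∷ xs} (a ∷ _) (suc i) zero    eq = ⊥-elim (All.lookup a (∈-lookup i) (sym eq))
lookup-injective {xs = x ∷ xs} (_ ∷ u) (suc i) (suc j) eq = cong suc (lookup-injective u i j eq)

module _ {n : ℕ} where

  -- Being in line on the board. Contact of the head of one arc with the tail of the other is
  -- deliberately left out, as it adds nothing to the index.
  Touching : Arc n → Arc n → Set
  Touching e f = proj₁ e ≡ proj₁ f ⊎ proj₂ e ≡ proj₂ f

  apart-cases : (e f : Arc n) → Touching e f ⊎ apart e f ≡ 1
  apart-cases e f with proj₁ e Fin.≟ proj₁ f | proj₂ e Fin.≟ proj₂ f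
  ... | yes p | _     = inj₁ (inj₁ p)
  ... | no _  | yes q = inj₁ (inj₂ q)
  ... | no _  | no _  = inj₂ refl

  touching⇒apart≡0 : {e f : Arc n} → Touching e f → apart e f ≡ 0
  touching⇒apart≡0 {e} {f} (inj₁ p) with proj₁ e Fin.≟ proj₁ f
  ... | yes _ = 0∸n≡0 (δ (proj₂ e) (proj₂ f))
  ... | no ¬p = ⊥-elim (¬p p)
  touching⇒apart≡0 {e} {f} (inj₂ q) with proj₁ e Fin.≟ proj₁ f | proj₂ e Fin.≟ proj₂ f
  ... | yes _ | yes _ = refl
  ... | no _  | yes _ = refl
  ... | _     | no ¬q = ⊥-elim (¬q q)

  apart⇒¬touching : {e f : Arc n} {k : ℕ} → apart e f ≡ suc k → ¬ Touching e f
  apart⇒¬touching {e} {f} eq t with trans (sym eq) (touching⇒apart≡0 {e} {f} t)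
  ... | ()

  apart-sym : (e f : Arc n) → apart e f ≡ apart f e
  apart-sym e f = cong (1 ∸_) (common-sym e f)

  -- Counting a pair only at its earlier arc lets an explicit list unfold into one finite sum, both
  -- for the linear rearrangements below and for evaluation on the small board.
  conflictPairs : List (Arc n) → ℕ
  conflictPairs []      = 0
  conflictPairs (e ∷ N) = ∑ N (apart e) + conflictPairs N

  conflict≡2*pairs : (N : List (Arc n)) → conflict N ≡ 2 * conflictPairs N
  conflict≡2*pairs []      = refl
  conflict≡2*pairs (e ∷ N) = begin
    (apart e e + ∑ N (apart e)) + (∑[ f ∈ N ] apart f e + ∑ N (apart f))
      ≡⟨ cong₂ _+_ (cong (_+ ∑ N (apart e)) (touching⇒apart≡0 {e} {e} (inj₁ refl)))
                   (trans (∑-+ (λ f → apart f e) (λ f → ∑ N (apart f)) N)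
                          (cong₂ _+_ (∑-cong N λ f → apart-sym f e) (conflict≡2*pairs N))) ⟩
    ∑ N (apart e) + (∑ N (apart e) + 2 * conflictPairs N)
      ≡⟨ solve 2 (λ a c → a :+ (a :+ con 2 :* c) := con 2 :* (a :+ c)) refl (∑ N (apart e)) (conflictPairs N) ⟩
    2 * (∑ N (apart e) + conflictPairs N) ∎
    where
    open ≡-Reasoning
    open +-*-Solver

  conflict-↭ : {N N′ : List (Arc n)} → N ↭ N′ → conflict N ≡ conflict N′
  conflict-↭ {N} {N′} p = trans (∑-↭ _ p) (∑-cong N′ λ e → ∑-↭ (apart e) p)

  conflict≡0⇒touching : {N : List (Arc n)} → conflict N ≡ 0 → ∀ {e f} → e ∈ N → f ∈ N → Touching e f
  conflict≡0⇒touching {N} eq {e} {f} e∈ f∈ with apart-cases e f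
  ... | inj₁ t = t
  ... | inj₂ a with ≤-trans (≤-reflexive (sym a)) (≤-trans (∑-member-≤ (apart e) f∈)
                    (≤-trans (∑-member-≤ (λ e → ∑ N (apart e)) e∈) (≤-reflexive eq)))
  ...   | ()

  -- Say the first two arcs share their tail. An arc in line with both but outside that row would
  -- share its head with each of them, and the two would coincide. The other case is symmetric.
  conflict-free⇒star : {N : List (Arc n)} → Unique N → 2 ≤ length N → conflict N ≡ 0 →
                       (∃[ c ] ∀ {e} → e ∈ N → proj₁ e ≡ c) ⊎ (∃[ c ] ∀ {e} → e ∈ N → proj₂ e ≡ c)
  conflict-free⇒star {_ ∷ []} _ (s≤s ()) _
  conflict-free⇒star {N@(e ∷ f ∷ _)} ((e≢f ∷ _) ∷ _) _ eq
    with conflict≡0⇒touching {N} eq {e} {f} (here refl) (there (here refl))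
  ... | inj₁ p = inj₁ (proj₁ e , star)
    where
    star : ∀ {g} → g ∈ N → proj₁ g ≡ proj₁ e
    star {g} g∈ with conflict≡0⇒touching {N} eq {g} {e} g∈ (here refl)
                   | conflict≡0⇒touching {N} eq {g} {f} g∈ (there (here refl))
    ... | inj₁ r | _      = r
    ... | inj₂ _ | inj₁ s = trans s (sym p)
    ... | inj₂ r | inj₂ s = ⊥-elim (e≢f (cong₂ _,_ p (trans (sym r) s)))
  ... | inj₂ q = inj₂ (proj₂ e , star)
    where
    star : ∀ {g} → g ∈ N → proj₂ g ≡ proj₂ e
    star {g} g∈ with conflict≡0⇒touching {N} eq {g} {e} g∈ (here refl)
                   | conflict≡0⇒touching {N} eq {g} {f} g∈ (there (here refl))
    ... | inj₂ r | _      = r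
    ... | inj₁ _ | inj₂ s = trans s (sym q)
    ... | inj₁ r | inj₁ s = ⊥-elim (e≢f (cong₂ _,_ (trans (sym r) s) q))

  conflict⇒apart-pair : {N : List (Arc n)} {k : ℕ} → conflict N ≡ suc k →
                        ∃[ e ] ∃[ f ] ∃[ R ] N ↭ e ∷ f ∷ R × ¬ Touching e f
  conflict⇒apart-pair {N} eq with ∑-positive _ N eq
  ... | e , e∈ , _ , eq′ with ∑-positive (apart e) N eq′
  ...   | f , f∈ , _ , ef with unique⊆⇒↭ {xs = e ∷ f ∷ []} ((e≢f ∷ []) ∷ [] ∷ [])
                                (λ { (here refl) → e∈ ; (there (here refl)) → f∈ })
    where
    e≢f : e ≢ f
    e≢f refl = apart⇒¬touching {e} {e} ef (inj₁ refl)
  ...     | R , p = e , f , R , p , apart⇒¬touching {e} {f} ef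

  module _ {e f : Arc n} (e∦f : ¬ Touching e f) where

    weight : Arc n → ℕ
    weight g = apart e g + apart f g

    -- The only arcs touching both e and f are the two mixed ones, and these do not touch each other.
    touching-both : ∀ {g} → Touching e g → Touching f g → g ≡ (proj₁ e , proj₂ f) ⊎ g ≡ (proj₁ f , proj₂ e)
    touching-both (inj₁ p) (inj₁ q) = ⊥-elim (e∦f (inj₁ (trans p (sym q))))
    touching-both (inj₁ p) (inj₂ q) = inj₁ (cong₂ _,_ (sym p) (sym q))
    touching-both (inj₂ p) (inj₁ q) = inj₂ (cong₂ _,_ (sym q) (sym p))
    touching-both (inj₂ p) (inj₂ q) = ⊥-elim (e∦f (inj₂ (trans p (sym q))))

    weight-zero : ∀ g → weight g ≡ 0 → g ≡ (proj₁ e , proj₂ f) ⊎ g ≡ (proj₁ f , proj₂ e)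
    weight-zero g w≡0 with apart-cases e g | apart-cases f g
    ... | inj₁ p  | inj₁ q  = touching-both p q
    ... | inj₁ _  | inj₂ fg with trans (sym (trans (cong (apart e g +_) fg) (+-comm _ 1))) w≡0
    ...   | ()
    weight-zero g w≡0 | inj₂ eg | _ with trans (sym (cong (_+ apart f g) eg)) w≡0
    ...   | ()

    -- If both weights vanish, `g` and `h` are the two mixed arcs, and these are apart from each
    -- other.
    weight-pair : ∀ {g h} → g ≢ h → 1 ≤ weight g + weight h + apart g h
    weight-pair {g} {h} g≢h with weight g in wg | weight h in wh | apart-cases g h
    ... | suc _ | _     | _       = s≤s z≤n
    ... | zero  | suc _ | _       = s≤s z≤n
    ... | zero  | zero  | inj₂ gh = ≤-reflexive (sym gh)
    ... | zero  | zero  | inj₁ t with weight-zero g wg | weight-zero h wh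
    ...   | inj₁ refl | inj₁ refl = ⊥-elim (g≢h refl)
    ...   | inj₂ refl | inj₂ refl = ⊥-elim (g≢h refl)
    ...   | inj₁ refl | inj₂ refl = ⊥-elim (e∦f (Sum.map id sym t))
    ...   | inj₂ refl | inj₁ refl = ⊥-elim (e∦f (Sum.map sym id t))

    private
      ef≡1 : apart e f ≡ 1
      ef≡1 with apart-cases e f
      ... | inj₁ t  = ⊥-elim (e∦f t)
      ... | inj₂ eq = eq

      -- No single unit serves all three hypotheses. If x = 0, the first two draw on disjoint terms;
      -- if x is positive, it gives one unit and the third hypothesis, in which x does not occur,
      -- gives another.
      two-of-three : ∀ x y z p q r → 1 ≤ x + y + p → 1 ≤ x + z + q → 1 ≤ y + z + r → 2 ≤ (x + y + z) + (p + q + r)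
      two-of-three zero y z p q r h₁ h₂ _ = ≤-trans (+-mono-≤ h₁ h₂) (≤-trans (m≤m+n _ r) (≤-reflexive
        (solve 5 (λ y z p q r → (y :+ p) :+ (z :+ q) :+ r := (y :+ z) :+ (p :+ q :+ r)) refl y z p q r)))
        where open +-*-Solver
      two-of-three (suc x) y z p q r _ _ h₃ = s≤s (≤-trans h₃ (≤-trans (m≤m+n _ (x + p + q)) (≤-reflexive
        (solve 6 (λ x y z p q r → (y :+ z :+ r) :+ (x :+ p :+ q) := (x :+ y :+ z) :+ (p :+ q :+ r)) refl x y z p q r))))
        where open +-*-Solver

    -- One conflict is the pair `e`, `f` itself and one comes from `weight-pair`; `rest` collects
    -- the terms that are given away.
    pairs≥2 : ∀ {g h R} → g ≢ h → 2 ≤ conflictPairs (e ∷ f ∷ g ∷ h ∷ R)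
    pairs≥2 {g} {h} {R} g≢h = ≤-trans (s≤s (weight-pair g≢h)) (≤-trans (m≤m+n _ rest) (≤-reflexive (begin
      1 + S + rest
        ≡⟨ cong (λ z → z + S + rest) (sym ef≡1) ⟩
      apart e f + S + rest
        ≡⟨ solve 10 (λ ef eg eh fg fh gh a b c d →
             (ef :+ ((eg :+ fg) :+ (eh :+ fh) :+ gh)) :+ (a :+ b :+ c :+ d)
             := (ef :+ (eg :+ (eh :+ a))) :+ ((fg :+ (fh :+ b)) :+ ((gh :+ c) :+ d))) refl
             (apart e f) (apart e g) (apart e h) (apart f g) (apart f h) (apart g h)
             (∑ R (apart e)) (∑ R (apart f)) (∑ R (apart g)) (conflictPairs (h ∷ R)) ⟩
      conflictPairs (e ∷ f ∷ g ∷ h ∷ R) ∎)))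
      where
      open ≡-Reasoning
      open +-*-Solver
      S rest : ℕ
      S    = weight g + weight h + apart g h
      rest = ∑ R (apart e) + ∑ R (apart f) + ∑ R (apart g) + conflictPairs (h ∷ R)

    -- Besides the pair `e`, `f`, `weight-pair` applies to each of the three pairs among `g`, `h`,
    -- `i`, and `two-of-three` turns this into two more conflicts.
    pairs≥3 : ∀ {g h i R} → g ≢ h → g ≢ i → h ≢ i → 3 ≤ conflictPairs (e ∷ f ∷ g ∷ h ∷ i ∷ R)
    pairs≥3 {g} {h} {i} {R} g≢h g≢i h≢i = ≤-trans
      (s≤s (two-of-three (weight g) (weight h) (weight i) (apart g h) (apart g i) (apart h i)
             (weight-pair g≢h) (weight-pair g≢i) (weight-pair h≢i)))
      (≤-trans (m≤m+n _ rest) (≤-reflexive (begin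
        1 + S + rest
          ≡⟨ cong (λ z → z + S + rest) (sym ef≡1) ⟩
        apart e f + S + rest
          ≡⟨ solve 15 (λ ef eg eh ei fg fh fi gh gi hi a b c d k →
               ef :+ (((eg :+ fg) :+ (eh :+ fh) :+ (ei :+ fi)) :+ (gh :+ gi :+ hi)) :+ (a :+ b :+ c :+ d :+ k)
               := (ef :+ (eg :+ (eh :+ (ei :+ a)))) :+
                  ((fg :+ (fh :+ (fi :+ b))) :+ ((gh :+ (gi :+ c)) :+ ((hi :+ d) :+ k)))) refl
               (apart e f) (apart e g) (apart e h) (apart e i) (apart f g) (apart f h) (apart f i)
               (apart g h) (apart g i) (apart h i)
               (∑ R (apart e)) (∑ R (apart f)) (∑ R (apart g)) (∑ R (apart h)) (conflictPairs (i ∷ R)) ⟩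
        conflictPairs (e ∷ f ∷ g ∷ h ∷ i ∷ R) ∎)))
      where
      open ≡-Reasoning
      open +-*-Solver
      S rest : ℕ
      S    = (weight g + weight h + weight i) + (apart g h + apart g i + apart h i)
      rest = ∑ R (apart e) + ∑ R (apart f) + ∑ R (apart g) + ∑ R (apart h) + conflictPairs (i ∷ R)

-- The case m = 3 without misfits: four arcs inside the off-diagonal cells of a 3 × 3 board

offDiagonal : List (Arc 3)
offDiagonal = filter (λ e → ¬? (proj₁ e Fin.≟ proj₂ e)) (cartesianProduct (allFin 3) (allFin 3))

-- With rows and columns as vertices and cells as edges, the off-diagonal board is a six-cycle. Four
-- of its edges meet in at most three of their six pairs. The proof evaluates all quadruples of
-- cells.
offDiagonal-pairs : All (λ a → All (λ b → All (λ c → All (λ d →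
  Unique (a ∷ b ∷ c ∷ d ∷ []) → 3 ≤ conflictPairs (a ∷ b ∷ c ∷ d ∷ [])) offDiagonal) offDiagonal) offDiagonal) offDiagonal
offDiagonal-pairs = from-yes
  (All.all? (λ a → All.all? (λ b → All.all? (λ c → All.all? (λ d →
    unique? (≡-dec Fin._≟_ Fin._≟_) (a ∷ b ∷ c ∷ d ∷ []) →-dec (3 ≤? conflictPairs (a ∷ b ∷ c ∷ d ∷ [])))
    offDiagonal) offDiagonal) offDiagonal) offDiagonal)

module _ {n : ℕ} (t h : Fin 3 → Fin n) (t-inj : ∀ i j → t i ≡ t j → i ≡ j) (h-inj : ∀ i j → h i ≡ h j → i ≡ j) where

  private
    place : Arc 3 → Arc n
    place (i , j) = t i , h j

    touching-place⁻ : ∀ {a b} → Touching (place a) (place b) → Touching a b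
    touching-place⁻ = Sum.map (t-inj _ _) (h-inj _ _)

    touching-place⁺ : ∀ {a b} → Touching a b → Touching (place a) (place b)
    touching-place⁺ = Sum.map (cong t) (cong h)

    apart-place : ∀ a b → apart (place a) (place b) ≡ apart a b
    apart-place a b with apart-cases a b | apart-cases (place a) (place b)
    ... | inj₁ p | _      = trans (touching⇒apart≡0 (touching-place⁺ p)) (sym (touching⇒apart≡0 {3} {a} {b} p))
    ... | inj₂ p | inj₂ q = trans q (sym p)
    ... | inj₂ p | inj₁ q = ⊥-elim (apart⇒¬touching {3} {a} {b} p (touching-place⁻ q))

    conflictPairs-place : ∀ N → conflictPairs (map place N) ≡ conflictPairs N
    conflictPairs-place []      = refl
    conflictPairs-place (a ∷ N) = cong₂ _+_
      (trans (∑-map (apart (place a)) place N) (∑-cong N (apart-place a))) (conflictPairs-place N)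

    lift-place : ∀ N → (∀ {e} → e ∈ N → ∃[ a ] e ≡ place a × proj₁ a ≢ proj₂ a) →
                 ∃[ N′ ] N ≡ map place N′ × All (_∈ offDiagonal) N′
    lift-place []      _    = [] , refl , []
    lift-place (e ∷ N) find with find (here refl) | lift-place N (find ∘ there)
    ... | a , refl , a∉ | N′ , refl , all = a ∷ N′ , refl ,
      ∈-filter⁺ (λ e → ¬? (proj₁ e Fin.≟ proj₂ e)) (∈-cartesianProduct⁺ (∈-allFin (proj₁ a)) (∈-allFin (proj₂ a))) a∉ ∷ all

  board-pairs≥3 : ∀ N → Unique N → length N ≡ 4 → (∀ {e} → e ∈ N → ∃[ i ] ∃[ j ] e ≡ (t i , h j) × i ≢ j) →
                  3 ≤ conflictPairs N
  board-pairs≥3 N u |N| find with lift-place N (λ i → let (i , j , eq , ne) = find i in (i , j) , eq , ne)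
  ... | a ∷ b ∷ c ∷ d ∷ [] , refl , a∈ ∷ b∈ ∷ c∈ ∷ d∈ ∷ [] =
    subst (3 ≤_) (sym (conflictPairs-place (a ∷ b ∷ c ∷ d ∷ [])))
      (All.lookup (All.lookup (All.lookup (All.lookup offDiagonal-pairs a∈) b∈) c∈) d∈ (Unique.map⁻ u))

-- Spiders

spiderArcs : ∀ {n} → Arc n → Arc n → Arc n → List (Arc n) → List (Arc n)
spiderArcs e₀ e₁ e₂ R = (e₀ ∷ e₁ ∷ e₂ ∷ R) ++ map (proj₁ e₀ ,_) (proj₁ e₁ ∷ proj₁ e₂ ∷ heads (e₁ ∷ e₂ ∷ R))

-- The structure of B⁽¹⁾: the matching e₀, e₁, e₂, R together with arcs from the tail of e₀ (the centre c; the
-- head of e₀ is the pendent vertex) to both ends of e₁ and e₂ (the triangles) and to all heads of R (the paths).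
record Spider (m : ℕ) {n : ℕ} (D : Digraph n) : Set where
  field
    e₀ e₁ e₂    : Arc n
    R           : List (Arc n)
    ends-unique : Unique (endpoints (e₀ ∷ e₁ ∷ e₂ ∷ R))
    length-M    : length (e₀ ∷ e₁ ∷ e₂ ∷ R) ≡ m
    arc⇒        : ∀ {u v} → D u v ≡ true → (u , v) ∈ spiderArcs e₀ e₁ e₂ R
    arc⇐        : ∀ {u v} → (u , v) ∈ spiderArcs e₀ e₁ e₂ R → D u v ≡ true

  M : List (Arc n)
  M = e₀ ∷ e₁ ∷ e₂ ∷ R

module _ {n : ℕ} where

  endpoints-resp-↭ : {M M′ : List (Arc n)} → M ↭ M′ → endpoints M ↭ endpoints M′
  endpoints-resp-↭ {M} {M′} p =
    ↭-trans (endpoints↭ M) (↭-trans (++⁺ (map⁺ proj₁ p) (map⁺ proj₂ p)) (↭-sym (endpoints↭ M′)))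

  star≡map : {c : Fin n} (N : List (Arc n)) → (∀ {e} → e ∈ N → proj₁ e ≡ c) → N ≡ map (c ,_) (heads N)
  star≡map []      _  = refl
  star≡map (e ∷ N) eq = cong₂ _∷_ (cong (_, proj₂ e) (eq (here refl))) (star≡map N (eq ∘ there))

module _ {m n : ℕ} {D : Digraph n} {M : List (Arc n)} (S : Split m D M) where

  open Split S

  tail⊎head : ∀ v → v ∈ tails M ⊎ v ∈ heads M
  tail⊎head v = ∈-++⁻ (tails M) (∈-resp-↭ (endpoints↭ M) (covers v))

  #tails-∈ : ∀ {v} → v ∈ tails M → #tails M v ≡ 1
  #tails-∈ v∈ with ∈-map⁻ proj₁ v∈
  ... | _ , e∈ , refl = #tails-tail e∈

  #heads-∈ : ∀ {v} → v ∈ heads M → #heads M v ≡ 1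
  #heads-∈ v∈ with ∈-map⁻ proj₂ v∈
  ... | _ , e∈ , refl = #heads-head e∈

  #heads-tail : ∀ {v} → v ∈ tails M → #heads M v ≡ 0
  #heads-tail {v} v∈ = +-cancelˡ-≡ 1 _ _ (trans (cong (_+ #heads M v) (sym (#tails-∈ v∈))) (#ends v))

  #tails-head : ∀ {v} → v ∈ heads M → #tails M v ≡ 0
  #tails-head {v} v∈ = +-cancelʳ-≡ 1 _ _ (trans (cong (#tails M v +_) (sym (#heads-∈ v∈))) (#ends v))

  #heads≡0⇒tail : ∀ {v} → #heads M v ≡ 0 → v ∈ tails M
  #heads≡0⇒tail {v} eq with tail⊎head v
  ... | inj₁ v∈ = v∈
  ... | inj₂ v∈ with trans (sym eq) (#heads-∈ v∈)
  ...   | ()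

  #tails≡0⇒head : ∀ {v} → #tails M v ≡ 0 → v ∈ heads M
  #tails≡0⇒head {v} eq with tail⊎head v
  ... | inj₂ v∈ = v∈
  ... | inj₁ v∈ with trans (sym eq) (#tails-∈ v∈)
  ...   | ()

  N-arc : ∀ {u v} → (u , v) ∈ N → D u v ≡ true
  N-arc = ∈-arcs⁻ D ∘ ∈-resp-↭ (↭-sym arcs↭) ∘ ∈-++⁺ʳ M

  module _ {c : Fin n} (star : ∀ {e} → e ∈ N → proj₁ e ≡ c) where

    private
      module _ {c′ : Fin n} (cc′ : (c , c′) ∈ M) where

        toTail? = λ (e : Arc n) → DecMembership._∈?_ Fin._≟_ (proj₂ e) (tails M)

        NT NH : List (Arc n)
        NT = filter toTail? N
        NH = proj₁ (filter-split toTail? N)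

        N↭ : N ↭ NT ++ NH
        N↭ = proj₁ (proj₂ (filter-split toTail? N))

        NH⊆N : ∀ {e} → e ∈ NH → e ∈ N
        NH⊆N = proj₁ ∘ proj₂ (proj₂ (filter-split toTail? N))

        NH-toHead : ∀ {e} → e ∈ NH → proj₂ e ∈ heads M
        NH-toHead {e} e∈ with tail⊎head (proj₂ e)
        ... | inj₁ i = ⊥-elim (proj₂ (proj₂ (proj₂ (filter-split toTail? N)) e∈) i)
        ... | inj₂ i = i

        NT⊆N : ∀ {e} → e ∈ NT → e ∈ N × proj₂ e ∈ tails M
        NT⊆N = ∈-filter⁻ toTail?

        ∈NT : ∀ {K e} → NT ≡ K → e ∈ K → e ∈ N × proj₂ e ∈ tails M
        ∈NT refl = NT⊆N

        NH≡ : NH ≡ map (c ,_) (heads NH)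
        NH≡ = star≡map NH (star ∘ NH⊆N)

        c∈tails : c ∈ tails M
        c∈tails = ∈-map⁺ proj₁ cc′

        -- The common tail `c` of the arcs of `N` is also a tail of `M`, so only the far ends can be
        -- misfits.
        misfit≡ : misfit M N ≡ length NT
        misfit≡ = begin
          misfit M N
            ≡⟨ ∑-cong-∈ N (λ {e} e∈ → cong (_+ #tails M (proj₂ e)) (trans (cong (#heads M) (star e∈)) (#heads-tail c∈tails))) ⟩
          (∑[ e ∈ N ] #tails M (proj₂ e))
            ≡⟨ trans (∑-↭ _ N↭) (∑-++ _ NT NH) ⟩
          (∑[ e ∈ NT ] #tails M (proj₂ e)) + (∑[ e ∈ NH ] #tails M (proj₂ e))
            ≡⟨ cong₂ _+_ (∑-cong-∈ NT (#tails-∈ ∘ proj₂ ∘ NT⊆N)) (∑-zero NH (#tails-head ∘ NH-toHead)) ⟩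
          ∑ NT (λ _ → 1) + 0
            ≡⟨ trans (+-identityʳ _) (trans (∑-const 1 NT) (*-identityʳ _)) ⟩
          length NT ∎
          where open ≡-Reasoning

        -- An arc of `N` from `c` to `c′` would be the matching arc at `c` itself. Arcs of a star
        -- with common tail differ in their heads, which separates the remaining entries.
        other-heads-unique : Unique (c′ ∷ heads NH)
        other-heads-unique = All.tabulate c′≢ ∷
          Unique.map⁻ (subst Unique NH≡ (unique-++ʳ NT (Unique-resp-↭ N↭ N-unique)))
          where
          c′≢ : ∀ {v} → v ∈ heads NH → c′ ≢ v
          c′≢ v∈ refl with ∈-map⁻ proj₂ v∈
          ... | e , e∈ , refl = M-N-disjoint (subst (_∈ M) (cong (_, proj₂ e) (sym (star (NH⊆N e∈)))) cc′) (NH⊆N e∈)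

        other-heads⊆ : ∀ {v} → v ∈ c′ ∷ heads NH → v ∈ heads M
        other-heads⊆ (here refl) = ∈-map⁺ proj₂ cc′
        other-heads⊆ (there v∈) with ∈-map⁻ proj₂ v∈
        ... | _ , e∈ , refl = NH-toHead e∈

        |NT|+|NH| : length NT + length NH ≡ suc m
        |NT|+|NH| = trans (sym (length-++ NT)) (trans (sym (↭-length N↭)) length-N)

        |NH|<m : suc (length NH) ≤ m
        |NH|<m = ≤-trans (≤-reflexive (cong suc (sym (length-map proj₂ NH))))
          (≤-trans (unique⊆⇒length≤ other-heads-unique other-heads⊆)
                   (≤-reflexive (trans (length-map proj₂ M) length-M)))

        -- The two arcs into tails of `M` single out the matching arcs `e₁` and `e₂`, whose tails
        -- they hit. The other m - 1 arcs of `N` then have to reach every head of `M` except `c′`,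
        -- so the heads of `e₁` and `e₂` are reached too and both triangles close.
        two⇒spider : ∀ {e f} → NT ≡ e ∷ f ∷ [] → Spider m D
        two⇒spider {e} {f} NT≡ with ∈-map⁻ proj₁ (proj₂ (∈NT NT≡ (here refl)))
                                  | ∈-map⁻ proj₁ (proj₂ (∈NT NT≡ (there (here refl))))
        ... | e₁ , e₁∈ , pe | e₂ , e₂∈ , pf = record
          { e₀ = e₀ ; e₁ = e₁ ; e₂ = e₂ ; R = R
          ; ends-unique = Unique-resp-↭ (endpoints-resp-↭ M↭) ends-unique
          ; length-M    = trans (sym (↭-length M↭)) length-M
          ; arc⇒        = ∈-resp-↭ arcs↭spider ∘ ∈-arcs⁺ D
          ; arc⇐        = ∈-arcs⁻ D ∘ ∈-resp-↭ (↭-sym arcs↭spider) }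
          where
          e₀ : Arc n
          e₀ = c , c′

          e-NT : e ∈ N × proj₂ e ∈ tails M
          e-NT = ∈NT NT≡ (here refl)
          f-NT : f ∈ N × proj₂ f ∈ tails M
          f-NT = ∈NT NT≡ (there (here refl))

          e≡ : e ≡ (c , proj₁ e₁)
          e≡ = cong₂ _,_ (star (proj₁ e-NT)) pe
          f≡ : f ≡ (c , proj₁ e₂)
          f≡ = cong₂ _,_ (star (proj₁ f-NT)) pf

          -- If `h` were the matching arc at the centre, the spoke `g` to its tail would be a loop.
          c≢tail : ∀ {g h} → g ∈ N → g ≡ (c , proj₁ h) → e₀ ≢ h
          c≢tail g∈ refl refl with trans (sym (loopless c)) (N-arc g∈)
          ... | ()

          e≢f : e ≢ f
          e≢f with subst Unique NT≡ (unique-++ˡ NT (Unique-resp-↭ N↭ N-unique))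
          ... | (e≢f ∷ _) ∷ _ = e≢f

          e₁≢e₂ : e₁ ≢ e₂
          e₁≢e₂ refl = e≢f (trans e≡ (sym f≡))

          extraction : ∃[ R ] M ↭ (e₀ ∷ e₁ ∷ e₂ ∷ []) ++ R
          extraction = unique⊆⇒↭
            ((c≢tail (proj₁ e-NT) e≡ ∷ c≢tail (proj₁ f-NT) f≡ ∷ []) ∷ (e₁≢e₂ ∷ []) ∷ [] ∷ [])
            λ { (here refl) → cc′ ; (there (here refl)) → e₁∈ ; (there (there (here refl))) → e₂∈ }

          R : List (Arc n)
          R = proj₁ extraction

          M↭ : M ↭ e₀ ∷ e₁ ∷ e₂ ∷ R
          M↭ = proj₂ extraction

          |NH|+1≡m : suc (length NH) ≡ m
          |NH|+1≡m = suc-injective (trans (cong (λ K → length K + length NH) (sym NT≡)) |NT|+|NH|)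

          heads-NH↭ : heads NH ↭ heads (e₁ ∷ e₂ ∷ R)
          -- `c′` together with the heads of `NH` makes m distinct heads of `M`, hence all of them;
          -- cancelling `c′` leaves the heads of the other matching arcs.
          heads-NH↭ = drop-∷ (↭-trans (↭-sym (unique⊆∧length⇒↭ other-heads-unique other-heads⊆
            (≤-reflexive (trans (length-map proj₂ M) (trans length-M
              (trans (sym |NH|+1≡m) (cong suc (sym (length-map proj₂ NH)))))))))
            (map⁺ proj₂ M↭))

          arcs↭spider : arcs D ↭ spiderArcs e₀ e₁ e₂ R
          arcs↭spider = ↭-trans arcs↭ (++⁺ M↭ (↭-trans N↭ (↭-trans (↭-reflexive (cong (_++ NH) NT≡))
            (↭-trans (↭-reflexive (cong₂ (λ a b → a ∷ b ∷ NH) e≡ f≡)) (prep _ (prep _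
              (↭-trans (↭-reflexive NH≡) (map⁺ (c ,_) heads-NH↭))))))))

        |NT|-cases : 3 ≤ length NT ⊎ (length NT ≡ 2 × Spider m D)
        |NT|-cases = go NT refl
          where
          go : ∀ K → NT ≡ K → 3 ≤ length NT ⊎ (length NT ≡ 2 × Spider m D)
          go [] eq = ⊥-elim (1+n≰n (≤-trans (n≤1+n _)
            (≤-trans (≤-reflexive (cong suc (sym (trans (cong (λ K → length K + length NH) (sym eq)) |NT|+|NH|)))) |NH|<m)))
          go (e ∷ []) eq = ⊥-elim (1+n≰n
            (≤-trans (≤-reflexive (sym (trans (cong (λ K → length K + length NH) (sym eq)) |NT|+|NH|))) |NH|<m))
          go (e ∷ f ∷ []) eq = inj₂ (cong length eq , two⇒spider eq)
          go (e ∷ f ∷ g ∷ K) eq = inj₁ (subst (λ K → 3 ≤ length K) (sym eq) (s≤s (s≤s (s≤s z≤n))))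

    out-star : 2 ≤ m → 3 ≤ misfit M N ⊎ (misfit M N ≡ 2 × Spider m D)
    out-star 2≤m with tail⊎head c
    ... | inj₂ c∈heads = inj₁ (begin
        3                  ≤⟨ s≤s 2≤m ⟩
        suc m              ≡⟨ length-N ⟨
        length N           ≡⟨ *-identityʳ (length N) ⟨
        length N * 1       ≡⟨ ∑-const 1 N ⟨
        ∑ N (λ _ → 1)      ≤⟨ ∑-mono-∈ N (λ e∈ → ≤-trans (≤-reflexive (sym
                                (trans (cong (#heads M) (star e∈)) (#heads-∈ c∈heads)))) (m≤m+n _ _)) ⟩
        misfit M N         ∎)
      where open ≤-Reasoning
    ... | inj₁ c∈tails with ∈-map⁻ proj₁ c∈tails
    ...   | (_ , c′) , cc′ , refl = subst (λ k → 3 ≤ k ⊎ (k ≡ 2 × Spider m D)) (sym (misfit≡ cc′)) (|NT|-cases cc′)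

-- Reversal

module _ {n : ℕ} where

  endpoints-swap : (M : List (Arc n)) → endpoints M ↭ endpoints (map swap M)
  endpoints-swap []            = ↭-refl
  endpoints-swap ((u , v) ∷ M) = Perm.swap u v (endpoints-swap M)

  -- Reversal exchanges the roles of tail and head in `M` and `N` at once, so opposite roles stay
  -- opposite.
  misfit-swap : (M N : List (Arc n)) → misfit (map swap M) (map swap N) ≡ misfit M N
  misfit-swap M N = trans (∑-map _ swap N) (∑-cong N λ e → trans
    (cong₂ _+_ (∑-map (λ f → δ (proj₂ e) (proj₂ f)) swap M) (∑-map (λ f → δ (proj₁ e) (proj₁ f)) swap M))
    (+-comm (#tails M (proj₂ e)) (#heads M (proj₁ e))))

  flip-split : ∀ {m} {D : Digraph n} {M} (S : Split m D M) → Split m (flip D) (map swap M)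
  flip-split {D = D} {M} S = record
    { N           = map swap N
    ; ends-unique = Unique-resp-↭ (endpoints-swap M) ends-unique
    ; covers      = λ v → ∈-resp-↭ (endpoints-swap M) (covers v)
    ; arcs↭       = ↭-trans flip-arcs (↭-trans (map⁺ swap arcs↭) (↭-reflexive (map-++ swap M N)))
    ; length-M    = trans (length-map swap M) length-M
    ; length-N    = trans (length-map swap N) length-N
    ; loopless    = loopless }
    where
    open Split S
    flip-arcs : arcs (flip D) ↭ map swap (arcs D)
    flip-arcs = unique⊆⊇⇒↭ (arcs-unique (flip D)) (Unique.map⁺ (cong swap) (arcs-unique D))
      (∈-map⁺ swap ∘ ∈-arcs⁺ D ∘ ∈-arcs⁻ (flip D))
      λ i → let (e , e∈ , eq) = ∈-map⁻ swap i in subst (_∈ arcs (flip D)) (sym eq) (∈-arcs⁺ (flip D) (∈-arcs⁻ D e∈))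

-- The defect

module _ {m n : ℕ} {D : Digraph n} where

  -- Without misfits, tails of `N` are tails of `M` and heads of `N` are heads of `M`. Indexing both
  -- by position in `M` puts the matching arcs on the diagonal, which `N` avoids.
  three-edges-misfit-free : (M : List (Arc n)) (S : Split m D M) → length M ≡ 3 → misfit M (Split.N S) ≡ 0 →
                            3 ≤ conflictPairs (Split.N S)
  three-edges-misfit-free M@(a ∷ b ∷ c ∷ []) S refl misfit≡0 =
    board-pairs≥3 (lookup (tails M)) (lookup (heads M))
      (lookup-injective (tails-unique M ends-unique)) (lookup-injective (heads-unique M ends-unique))
      N N-unique (trans length-N (cong suc (sym length-M))) find
    where
    open Split S

    diagonal : ∀ i → (lookup (tails M) i , lookup (heads M) i) ∈ M
    diagonal zero             = here refl
    diagonal (suc zero)       = there (here refl)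
    diagonal (suc (suc zero)) = there (there (here refl))

    find : ∀ {e} → e ∈ N → ∃[ i ] ∃[ j ] e ≡ (lookup (tails M) i , lookup (heads M) j) × i ≢ j
    find {e} e∈ = index te , index he , e≡ , λ i≡j → M-N-disjoint
      (subst (_∈ M) (sym (trans e≡ (cong (λ j → lookup (tails M) (index te) , lookup (heads M) j) (sym i≡j))))
        (diagonal (index te))) e∈
      where
      term≡0 : #heads M (proj₁ e) + #tails M (proj₂ e) ≡ 0
      term≡0 = n≤0⇒n≡0 (≤-trans (∑-member-≤ (λ e → #heads M (proj₁ e) + #tails M (proj₂ e)) e∈) (≤-reflexive misfit≡0))
      te : proj₁ e ∈ tails M
      te = #heads≡0⇒tail S (m+n≡0⇒m≡0 _ term≡0)
      he : proj₂ e ∈ heads M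
      he = #tails≡0⇒head S (m+n≡0⇒n≡0 (#heads M (proj₁ e)) term≡0)
      e≡ : e ≡ (lookup (tails M) (index te) , lookup (heads M) (index he))
      e≡ = cong₂ _,_ (lookup-index te) (lookup-index he)

-- The defect is twice P + Q, `conflict` being even; hence the jump from 4 to 6, which later
-- separates equality from strict inequality.
defect-cases : ∀ {m n} {D : Digraph n} {M : List (Arc n)} (S : Split m D M) → 3 ≤ m → let N = Split.N S in
               6 ≤ 2 * misfit M N + conflict N ⊎
               (2 * misfit M N + conflict N ≡ 4 × (Spider m D ⊎ Spider m (flip D)))
defect-cases {m} {n} {D} {M} S 3≤m = by-conflict (conflict N) refl
  where
  open Split S

  2≤m : 2 ≤ m
  2≤m = ≤-trans (n≤1+n 2) 3≤m

  Goal : Set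
  Goal = 6 ≤ 2 * misfit M N + conflict N ⊎ (2 * misfit M N + conflict N ≡ 4 × (Spider m D ⊎ Spider m (flip D)))

  by-star : {X : Set} → conflict N ≡ 0 → (X → Spider m D ⊎ Spider m (flip D)) →
            3 ≤ misfit M N ⊎ (misfit M N ≡ 2 × X) → Goal
  by-star eq spider (inj₁ q≥3)       = inj₁ (≤-trans (*-monoʳ-≤ 2 q≥3) (m≤m+n _ _))
  by-star eq spider (inj₂ (q≡2 , x)) = inj₂ (cong₂ (λ q c → 2 * q + c) q≡2 eq , spider x)

  pairs⇒defect≥6 : ∀ {k} → 3 ≤ k + misfit M N → k ≤ conflictPairs N → 6 ≤ 2 * misfit M N + conflict N
  pairs⇒defect≥6 {k} 3≤ k≤ = begin
    6                                       ≤⟨ *-monoʳ-≤ 2 3≤ ⟩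
    2 * (k + misfit M N)                    ≤⟨ *-monoʳ-≤ 2 (+-monoˡ-≤ (misfit M N) k≤) ⟩
    2 * (conflictPairs N + misfit M N)      ≡⟨ solve 2 (λ c q → con 2 :* (c :+ q) := con 2 :* q :+ con 2 :* c) refl
                                                 (conflictPairs N) (misfit M N) ⟩
    2 * misfit M N + 2 * conflictPairs N    ≡⟨ cong (2 * misfit M N +_) (conflict≡2*pairs N) ⟨
    2 * misfit M N + conflict N             ∎
    where
    open ≤-Reasoning
    open +-*-Solver

  pairs-↭ : ∀ {K} → N ↭ K → conflictPairs N ≡ conflictPairs K
  pairs-↭ {K} p = *-cancelˡ-≡ _ _ 2 (trans (sym (conflict≡2*pairs N)) (trans (conflict-↭ p) (conflict≡2*pairs K)))

  -- `N` has m + 1 ≥ 4 arcs, so at least two remain besides `e` and `f`, and exactly two only when m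
  -- = 3.
  by-rest : ∀ {e f} R → ¬ Touching e f → N ↭ e ∷ f ∷ R → Unique (e ∷ f ∷ R) → Goal
  by-rest [] _ p _ with ≤-trans (s≤s 3≤m) (≤-reflexive (trans (sym length-N) (↭-length p)))
  ... | s≤s (s≤s ())
  by-rest (_ ∷ []) _ p _ with ≤-trans (s≤s 3≤m) (≤-reflexive (trans (sym length-N) (↭-length p)))
  ... | s≤s (s≤s (s≤s ()))
  by-rest (g ∷ h ∷ []) e∦f p (_ ∷ _ ∷ (g≢h ∷ _) ∷ _) = by-misfit (misfit M N) refl
    where
    by-misfit : ∀ q → misfit M N ≡ q → Goal
    by-misfit zero eq = inj₁ (pairs⇒defect≥6 {3} (s≤s (s≤s (s≤s z≤n))) (three-edges-misfit-free M S
      (trans length-M (suc-injective (trans (sym length-N) (↭-length p)))) eq))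
    -- One misfit already supplies the unit by which `pairs≥2` falls short of three.
    by-misfit (suc _) eq = inj₁ (pairs⇒defect≥6 {2} (subst (λ q → 3 ≤ 2 + q) (sym eq) (s≤s (s≤s (s≤s z≤n))))
      (≤-trans (pairs≥2 e∦f {R = []} g≢h) (≤-reflexive (sym (pairs-↭ p)))))
  by-rest (g ∷ h ∷ i ∷ R) e∦f p (_ ∷ _ ∷ (g≢h ∷ g≢i ∷ _) ∷ (h≢i ∷ _) ∷ _) =
    inj₁ (pairs⇒defect≥6 {3} (s≤s (s≤s (s≤s z≤n)))
      (≤-trans (pairs≥3 e∦f {R = R} g≢h g≢i h≢i) (≤-reflexive (sym (pairs-↭ p)))))

  by-conflict : ∀ k → conflict N ≡ k → Goal
  by-conflict zero eq with conflict-free⇒star N-unique (≤-trans 2≤m (≤-trans (n≤1+n m) (≤-reflexive (sym length-N)))) eq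
  ... | inj₁ (_ , star) = by-star eq inj₁ (out-star S star 2≤m)
  ... | inj₂ (c , star) = by-star eq inj₂ (subst (λ q → 3 ≤ q ⊎ (q ≡ 2 × Spider m (flip D))) (misfit-swap M N)
    (out-star (flip-split S) {c} (λ i → let (e , e∈ , eq) = ∈-map⁻ swap i in trans (cong proj₁ eq) (star e∈)) 2≤m))
  by-conflict (suc k) eq with conflict⇒apart-pair eq
  ... | e , f , R , p , e∦f = by-rest R e∦f p (Unique-resp-↭ p N-unique)

-- Spiders attain the bound

-- An inequality suffices, as the upper bound holds for every orientation. It remains to bound the
-- defect of a spider by 4.
spider-defect : ∀ {m} {D : Digraph (2 * m)} → Loopless D → length (arcs D) ≡ 2 * m + 1 → Spider m D →
                m * m + 9 * m + 6 ≤ twiceM₁ D + 4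
spider-defect {m} {D} loop |arcs| spider = begin
  m * m + 9 * m + 6                            ≡⟨ twiceM₁-defect ⟨
  twiceM₁ D + (2 * misfit M N + conflict N)    ≤⟨ +-monoʳ-≤ (twiceM₁ D)
                                                    (+-mono-≤ (*-monoʳ-≤ 2 misfit≤2) (≤-reflexive conflict≡0)) ⟩
  twiceM₁ D + 4                                ∎
  where
  open ≤-Reasoning
  open Spider spider hiding (ends-unique; length-M)
  S : Split m D M
  S = mkSplit M loop |arcs| (Spider.ends-unique spider) (Spider.length-M spider)
        (λ i → ∈-arcs⁺ D (arc⇐ (∈-++⁺ˡ i)))
  open Split S

  c : Fin (2 * m)
  c = proj₁ e₀

  K : List (Arc (2 * m))
  K = map (c ,_) (proj₁ e₁ ∷ proj₁ e₂ ∷ heads (e₁ ∷ e₂ ∷ R))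

  N⊆K : ∀ {e} → e ∈ N → e ∈ K
  N⊆K e∈ with ∈-++⁻ M (arc⇒ (N-arc S e∈))
  ... | inj₁ i = ⊥-elim (M-N-disjoint i e∈)
  ... | inj₂ i = i

  conflict≡0 : conflict N ≡ 0
  conflict≡0 = ∑-zero N λ {e} e∈ → ∑-zero N λ {f} f∈ → touching⇒apart≡0 {e = e} {f} (inj₁ (trans (tail e∈) (sym (tail f∈))))
    where
    tail : ∀ {e} → e ∈ N → proj₁ e ≡ c
    tail e∈ with ∈-map⁻ (c ,_) (N⊆K e∈)
    ... | _ , _ , refl = refl

  #heads-c : #heads M c ≡ 0
  #heads-c = #heads-tail S (here refl)

  misfit≤2 : misfit M N ≤ 2
  -- `N` is obtained as a complement, so only its inclusion in the explicit spokes `K` is used, and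
  -- `misfit` grows with the list. The 2 counts the spokes to the tails of `e₁` and `e₂`.
  misfit≤2 with unique⊆⇒↭ N-unique N⊆K
  ... | Z , p = begin
    misfit M N
      ≤⟨ m≤m+n _ (misfit M Z) ⟩
    misfit M N + misfit M Z
      ≡⟨ ∑-++ _ N Z ⟨
    misfit M (N ++ Z)
      ≡⟨ ∑-↭ _ p ⟨
    misfit M K
      ≡⟨ ∑-map (λ e → #heads M (proj₁ e) + #tails M (proj₂ e)) (c ,_) (proj₁ e₁ ∷ proj₁ e₂ ∷ heads (e₁ ∷ e₂ ∷ R)) ⟩
    (∑[ v ∈ proj₁ e₁ ∷ proj₁ e₂ ∷ heads (e₁ ∷ e₂ ∷ R) ] #heads M c + #tails M v)
      ≡⟨ cong₂ _+_ (cong₂ _+_ #heads-c (#tails-∈ S (there (here refl))))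
          (cong₂ _+_ (cong₂ _+_ #heads-c (#tails-∈ S (there (there (here refl)))))
            (∑-zero (heads (e₁ ∷ e₂ ∷ R)) λ v∈ → cong₂ _+_ #heads-c (#tails-head S (there v∈)))) ⟩
    2 ∎

-- Isomorphisms of spiders

true-iff⇒≡ : {a b : Bool} → (a ≡ true → b ≡ true) → (b ≡ true → a ≡ true) → a ≡ b
true-iff⇒≡ {true}          f g = sym (f refl)
true-iff⇒≡ {false} {true}  f g = g refl
true-iff⇒≡ {false} {false} f g = refl

module _ {n : ℕ} where

  rename : List (Fin n) → List (Fin n) → Fin n → Fin n
  rename (x ∷ xs) (y ∷ ys) v with v Fin.≟ x
  ... | yes _ = y
  ... | no _  = rename xs ys v
  rename _ _ v = v

  map-rename : ∀ xs ys → Unique xs → length xs ≡ length ys → map (rename xs ys) xs ≡ ys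
  map-rename []       []       _       _  = refl
  map-rename (x ∷ xs) (y ∷ ys) (a ∷ u) eq = cong₂ _∷_ first
    (trans (map-cong-local (All.tabulate λ i → later (All.lookup a i))) (map-rename xs ys u (suc-injective eq)))
    where
    first : rename (x ∷ xs) (y ∷ ys) x ≡ y
    first with x Fin.≟ x
    ... | yes _  = refl
    ... | no x≢x = ⊥-elim (x≢x refl)
    later : ∀ {v} → x ≢ v → rename (x ∷ xs) (y ∷ ys) v ≡ rename xs ys v
    later {v} x≢v with v Fin.≟ x
    ... | yes v≡x = ⊥-elim (x≢v (sym v≡x))
    ... | no _    = refl

  map-fixes : (h : Fin n → Fin n) (xs : List (Fin n)) → map h xs ≡ xs → ∀ {v} → v ∈ xs → h v ≡ v
  map-fixes h (x ∷ xs) eq (here refl) = ∷-injectiveˡ eq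
  map-fixes h (x ∷ xs) eq (there i)   = map-fixes h xs (∷-injectiveʳ eq) i

  -- The composite maps the list `xs` to itself entry by entry, so it fixes every vertex listed
  -- there, that is, every vertex.
  rename-inverse : ∀ {xs ys} → Unique xs → Unique ys → length xs ≡ length ys → (∀ v → v ∈ xs) →
                   ∀ v → rename ys xs (rename xs ys v) ≡ v
  rename-inverse {xs} {ys} u u′ eq covers v = map-fixes (rename ys xs ∘ rename xs ys) xs
    (trans (map-∘ xs) (trans (cong (map (rename ys xs)) (map-rename xs ys u eq)) (map-rename ys xs u′ (sym eq)))) (covers v)

  mapArc : (Fin n → Fin n) → Arc n → Arc n
  mapArc f = Product.map f f

  endpoints-mapArc : (f : Fin n → Fin n) (M : List (Arc n)) → endpoints (map (mapArc f) M) ≡ map f (endpoints M)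
  endpoints-mapArc f []            = refl
  endpoints-mapArc f ((u , v) ∷ M) = cong (λ xs → f u ∷ f v ∷ xs) (endpoints-mapArc f M)

  endpoints-injective : (M M′ : List (Arc n)) → endpoints M ≡ endpoints M′ → M ≡ M′
  endpoints-injective []            []              _  = refl
  endpoints-injective ((u , v) ∷ M) ((u′ , v′) ∷ M′) eq = cong₂ _∷_
    (cong₂ _,_ (∷-injectiveˡ eq) (∷-injectiveˡ (∷-injectiveʳ eq)))
    (endpoints-injective M M′ (∷-injectiveʳ (∷-injectiveʳ eq)))

  map-star : (f : Fin n → Fin n) (c : Fin n) (xs : List (Fin n)) →
             map (mapArc f) (map (c ,_) xs) ≡ map (f c ,_) (map f xs)
  map-star f c xs = trans (sym (map-∘ xs)) (map-∘ xs)

  heads-mapArc : (f : Fin n → Fin n) (M : List (Arc n)) → map f (heads M) ≡ heads (map (mapArc f) M)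
  heads-mapArc f M = trans (sym (map-∘ M)) (map-∘ M)

  spiderArcs-cong : ∀ {e₀ e₁ e₂ e₀′ e₁′ e₂′ : Arc n} {R R′} → e₀ ≡ e₀′ → e₁ ≡ e₁′ → e₂ ≡ e₂′ → R ≡ R′ →
                    spiderArcs e₀ e₁ e₂ R ≡ spiderArcs e₀′ e₁′ e₂′ R′
  spiderArcs-cong refl refl refl refl = refl

  map-spiderArcs : (f : Fin n → Fin n) (e₀ e₁ e₂ : Arc n) (R : List (Arc n)) →
    map (mapArc f) (spiderArcs e₀ e₁ e₂ R) ≡ spiderArcs (mapArc f e₀) (mapArc f e₁) (mapArc f e₂) (map (mapArc f) R)
  map-spiderArcs f e₀ e₁ e₂ R = trans (map-++ (mapArc f) (e₀ ∷ e₁ ∷ e₂ ∷ R) _)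
    (cong (map (mapArc f) (e₀ ∷ e₁ ∷ e₂ ∷ R) ++_)
      (trans (map-star f (proj₁ e₀) (proj₁ e₁ ∷ proj₁ e₂ ∷ heads (e₁ ∷ e₂ ∷ R)))
        (cong (λ xs → map (f (proj₁ e₀) ,_) (f (proj₁ e₁) ∷ f (proj₁ e₂) ∷ xs)) (heads-mapArc f (e₁ ∷ e₂ ∷ R)))))

  ∈-spiderArcs : (f : Fin n → Fin n) {e₀ e₁ e₂ : Arc n} {R : List (Arc n)} {u v : Fin n} →
    (u , v) ∈ spiderArcs e₀ e₁ e₂ R →
    (f u , f v) ∈ spiderArcs (mapArc f e₀) (mapArc f e₁) (mapArc f e₂) (map (mapArc f) R)
  ∈-spiderArcs f {e₀} {e₁} {e₂} {R} {u} {v} i = subst ((f u , f v) ∈_) (map-spiderArcs f e₀ e₁ e₂ R) (∈-map⁺ (mapArc f) i)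

  -- The arcs of a spider are computed from its ordered matching alone, so a map that carries one
  -- matching to the other carries arcs to arcs.
  rename-arc : ∀ {m m′} {D E : Digraph n} (A : Spider m D) (B : Spider m′ E) (f : Fin n → Fin n) →
               map (mapArc f) (Spider.M A) ≡ Spider.M B → ∀ {u v} → D u v ≡ true → E (f u) (f v) ≡ true
  rename-arc A record { arc⇐ = arc⇐ } f refl Duv = arc⇐ (∈-spiderArcs f (Spider.arc⇒ A Duv))

  -- Transports the structure of `B1` to `D`, where the counting argument can be applied directly to
  -- find the value of the index.
  spider-≅-resp : ∀ {m} {D E : Digraph n} → D ≅ E → Spider m E → Spider m D
  spider-≅-resp {m} {D} {E} (f , D≡E) B = record
    { e₀ = mapArc from e₀ ; e₁ = mapArc from e₁ ; e₂ = mapArc from e₂ ; R = map (mapArc from) R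
    ; ends-unique = subst Unique (sym (endpoints-mapArc from M))
        (Unique.map⁺ (λ eq → trans (sym (strictlyInverseˡ _)) (trans (cong to eq) (strictlyInverseˡ _))) ends-unique)
    ; length-M = trans (length-map (mapArc from) M) length-M
    ; arc⇒ = λ {u} {v} Duv → subst₂ (λ x y → (x , y) ∈ pulledBack)
        (strictlyInverseʳ u) (strictlyInverseʳ v) (∈-spiderArcs from (arc⇒ (trans (sym (D≡E u v)) Duv)))
    ; arc⇐ = λ {u} {v} i → trans (D≡E u v) (arc⇐ (back i)) }
    where
    open Inverse f
    open Spider B
    pulledBack : List (Arc n)
    pulledBack = spiderArcs (mapArc from e₀) (mapArc from e₁) (mapArc from e₂) (map (mapArc from) R)
    to-from : ∀ e → mapArc to (mapArc from e) ≡ e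
    to-from e = cong₂ _,_ (strictlyInverseˡ _) (strictlyInverseˡ _)
    map-to-from : ∀ K → map (mapArc to) (map (mapArc from) K) ≡ K
    map-to-from []      = refl
    map-to-from (e ∷ K) = cong₂ _∷_ (to-from e) (map-to-from K)
    back : ∀ {u v} → (u , v) ∈ pulledBack → (to u , to v) ∈ spiderArcs e₀ e₁ e₂ R
    back {u} {v} i = subst ((to u , to v) ∈_) (spiderArcs-cong (to-from e₀) (to-from e₁) (to-from e₂) (map-to-from R))
      (∈-spiderArcs to {mapArc from e₀} {mapArc from e₁} {mapArc from e₂} {map (mapArc from) R} i)

-- The endpoint list of the matching enumerates all vertices once, in an order that records their
-- roles. Pairing two such lists position by position gives the bijection.
spiders-isomorphic : ∀ {m} {D E : Digraph (2 * m)} → Spider m D → Spider m E → D ≅ E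
spiders-isomorphic {m} {D} {E} A B = mk↔ₛ′ f g f∘g g∘f , λ u v → true-iff⇒≡ (rename-arc A B f map-f)
  (λ Euv → subst₂ (λ x y → D x y ≡ true) (g∘f u) (g∘f v) (rename-arc B A g map-g Euv))
  where
  module A = Spider A
  module B = Spider B
  f g : Fin (2 * m) → Fin (2 * m)
  f = rename (endpoints A.M) (endpoints B.M)
  g = rename (endpoints B.M) (endpoints A.M)
  |A| : length (endpoints A.M) ≡ 2 * m
  |A| = trans (endpoints-length A.M) (cong (2 *_) A.length-M)
  |B| : length (endpoints B.M) ≡ 2 * m
  |B| = trans (endpoints-length B.M) (cong (2 *_) B.length-M)
  f∘g : ∀ v → f (g v) ≡ v
  f∘g = rename-inverse B.ends-unique A.ends-unique (trans |B| (sym |A|)) (unique-length⇒covers B.ends-unique |B|)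
  g∘f : ∀ v → g (f v) ≡ v
  g∘f = rename-inverse A.ends-unique B.ends-unique (trans |A| (sym |B|)) (unique-length⇒covers A.ends-unique |A|)
  map-f : map (mapArc f) A.M ≡ B.M
  map-f = endpoints-injective _ _ (trans (endpoints-mapArc f A.M) (map-rename _ _ A.ends-unique (trans |A| (sym |B|))))
  map-g : map (mapArc g) B.M ≡ A.M
  map-g = endpoints-injective _ _ (trans (endpoints-mapArc g B.M) (map-rename _ _ B.ends-unique (trans |B| (sym |A|))))

-- B⁽¹⁾ is a spider

halve : ∀ k j → j < k * 2 → ∃[ i ] (j ≡ toℕ {k} i * 2 ⊎ j ≡ suc (toℕ i * 2))
halve (suc k) zero          _ = zero , inj₁ refl
halve (suc k) (suc zero)    _ = zero , inj₂ refl
halve (suc k) (suc (suc j)) (s≤s (s≤s j<)) with halve k j j<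
... | i , eq = suc i , Sum.map (cong (2 +_)) (cong (2 +_)) eq

-- A view of numbers rather than of vertices: matching on it gives the arguments of `B1arcℕ` enough
-- leading constructors for its Boolean tests to evaluate.
data Position (k : ℕ) : ℕ → Set where
  core : (i : Fin 6) → Position k (toℕ i)
  even : (i : Fin k) → Position k (6 + toℕ i * 2)
  odd  : (i : Fin k) → Position k (7 + toℕ i * 2)

position : ∀ k j → j < 6 + k * 2 → Position k j
position k 0 _ = core zero
position k 1 _ = core (suc zero)
position k 2 _ = core (suc (suc zero))
position k 3 _ = core (suc (suc (suc zero)))
position k 4 _ = core (suc (suc (suc (suc zero))))
position k 5 _ = core (suc (suc (suc (suc (suc zero)))))
position k (suc (suc (suc (suc (suc (suc j)))))) (s≤s (s≤s (s≤s (s≤s (s≤s (s≤s j<)))))) with halve k j j<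
... | i , inj₁ refl = even i
... | i , inj₂ refl = odd i

module _ (k : ℕ) where

  private
    m n : ℕ
    m = 3 + k
    n = 2 * m

    n≡ : n ≡ 6 + k * 2
    n≡ = solve 1 (λ k → con 2 :* (con 3 :+ k) := con 6 :+ k :* con 2) refl k
      where open +-*-Solver

    7+i*2<6+k*2 : (i : Fin k) → 7 + toℕ i * 2 < 6 + k * 2
    7+i*2<6+k*2 i = +-monoʳ-≤ 6 (*-monoˡ-≤ 2 (Fin.toℕ<n i))

    vertex : ∀ j → j < 6 + k * 2 → Fin n
    vertex j j< = fromℕ< (subst (j <_) (sym n≡) j<)

    toℕ-vertex : ∀ j j< → toℕ (vertex j j<) ≡ j
    toℕ-vertex j j< = Fin.toℕ-fromℕ< (subst (j <_) (sym n≡) j<)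

    coreVertex : Fin 6 → Fin n
    coreVertex i = vertex (toℕ i) (≤-trans (Fin.toℕ<n i) (m≤m+n 6 (k * 2)))

    evenVertex oddVertex : Fin k → Fin n
    evenVertex i = vertex (6 + toℕ i * 2) (<-trans (n<1+n _) (7+i*2<6+k*2 i))
    oddVertex  i = vertex (7 + toℕ i * 2) (7+i*2<6+k*2 i)

    toℕ-core : (i : Fin 6) → toℕ (coreVertex i) ≡ toℕ i
    toℕ-core i = toℕ-vertex (toℕ i) (≤-trans (Fin.toℕ<n i) (m≤m+n 6 (k * 2)))

    toℕ-even : (i : Fin k) → toℕ (evenVertex i) ≡ 6 + toℕ i * 2
    toℕ-even i = toℕ-vertex (6 + toℕ i * 2) (<-trans (n<1+n _) (7+i*2<6+k*2 i))

    toℕ-odd : (i : Fin k) → toℕ (oddVertex i) ≡ 7 + toℕ i * 2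
    toℕ-odd i = toℕ-vertex (7 + toℕ i * 2) (7+i*2<6+k*2 i)

    is-core : (i : Fin 6) {v : Fin n} → toℕ v ≡ toℕ i → v ≡ coreVertex i
    is-core i eq = Fin.toℕ-injective (trans eq (sym (toℕ-core i)))

    is-even : (i : Fin k) {v : Fin n} → toℕ v ≡ 6 + toℕ i * 2 → v ≡ evenVertex i
    is-even i eq = Fin.toℕ-injective (trans eq (sym (toℕ-even i)))

    is-odd : (i : Fin k) {v : Fin n} → toℕ v ≡ 7 + toℕ i * 2 → v ≡ oddVertex i
    is-odd i eq = Fin.toℕ-injective (trans eq (sym (toℕ-odd i)))

    c p x y x′ y′ : Fin n
    c  = coreVertex (# 0)
    x  = coreVertex (# 1)
    y  = coreVertex (# 2)
    x′ = coreVertex (# 3)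
    y′ = coreVertex (# 4)
    p  = coreVertex (# 5)

    R M : List (Arc n)
    R = map (λ i → oddVertex i , evenVertex i) (allFin k)
    M = (c , p) ∷ (x , y) ∷ (x′ , y′) ∷ R

    even∈heads : ∀ i → evenVertex i ∈ heads R
    even∈heads i = ∈-map⁺ proj₂ (∈-map⁺ _ (∈-allFin i))

    core∈M : ∀ i → coreVertex i ∈ endpoints M
    core∈M zero                                     = here refl
    core∈M (suc zero)                               = there (there (here refl))
    core∈M (suc (suc zero))                         = there (there (there (here refl)))
    core∈M (suc (suc (suc zero)))                   = there (there (there (there (here refl))))
    core∈M (suc (suc (suc (suc zero))))             = there (there (there (there (there (here refl)))))
    core∈M (suc (suc (suc (suc (suc zero)))))       = there (here refl)

    vertex∈M : ∀ {j} → Position k j → ∀ {v} → toℕ v ≡ j → v ∈ endpoints M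
    vertex∈M (core i) eq = subst (_∈ endpoints M) (sym (is-core i eq)) (core∈M i)
    vertex∈M (even i) eq = subst (_∈ endpoints M) (sym (is-even i eq))
      (∈-resp-↭ (↭-sym (endpoints↭ M)) (∈-++⁺ʳ (tails M) (there (there (there (even∈heads i))))))
    vertex∈M (odd i) eq = subst (_∈ endpoints M) (sym (is-odd i eq))
      (∈-resp-↭ (↭-sym (endpoints↭ M)) (∈-++⁺ˡ (there (there (there (∈-map⁺ proj₁ (∈-map⁺ _ (∈-allFin i))))))))

    pos : (v : Fin n) → Position k (toℕ v)
    pos v = position k (toℕ v) (subst (toℕ v <_) n≡ (Fin.toℕ<n v))

    |M| : length M ≡ m
    |M| = cong (3 +_) (trans (length-map _ (allFin k)) (length-tabulate id))

    -- The 2m endpoints reach all 2m vertices, so none of them repeats.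
    M-ends-unique : Unique (endpoints M)
    M-ends-unique = Unique-resp-↭ (↭-sym (unique⊆∧length⇒↭ (Unique.allFin⁺ n) (λ {v} _ → vertex∈M (pos v) refl)
      (≤-reflexive (trans (endpoints-length M) (trans (cong (2 *_) |M|) (sym (length-tabulate id)))))))
      (Unique.allFin⁺ n)

    parity-even : (i : Fin k) → (toℕ i * 2) % 2 ≡ 0
    parity-even i = m*n%n≡0 (toℕ i) 2

    parity-odd : (i : Fin k) → (1 + toℕ i * 2) % 2 ≡ 1
    parity-odd i = [m+kn]%n≡m%n 1 (toℕ i) 2

    -- The remainder modulo 2 computes through the six leading successors, so only the parity of
    -- `toℕ i * 2` is left to rewrite.
    arc-to-even : (i : Fin k) → B1arcℕ 0 (6 + toℕ i * 2) ≡ true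
    arc-to-even i = cong (λ r → (r ≡ᵇ 0) ∨ false) (parity-even i)

    arc-to-odd : (i : Fin k) → B1arcℕ 0 (7 + toℕ i * 2) ≡ false
    arc-to-odd i = cong (λ r → (r ≡ᵇ 0) ∨ false) (parity-odd i)

    arc-from-even : (i : Fin k) (b : ℕ) → B1arcℕ (6 + toℕ i * 2) b ≡ false
    arc-from-even i b = trans (cong (λ r → (0 <ᵇ toℕ i * 2) ∧ (r ≡ᵇ 1) ∧ (b ≡ᵇ 5 + toℕ i * 2)) (parity-even i))
                              (Bool.∧-zeroʳ _)

    arc-from-odd : (i : Fin k) (b : ℕ) → B1arcℕ (7 + toℕ i * 2) b ≡ (b ≡ᵇ 6 + toℕ i * 2)
    arc-from-odd i b = cong (λ r → (r ≡ᵇ 1) ∧ (b ≡ᵇ 6 + toℕ i * 2)) (parity-odd i)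

    ≡ᵇ-true⇒≡ : ∀ a b → (a ≡ᵇ b) ≡ true → a ≡ b
    ≡ᵇ-true⇒≡ a b eq = ≡ᵇ⇒≡ a b (subst T (sym eq) _)

    ≡ᵇ-refl : ∀ a → (a ≡ᵇ a) ≡ true
    ≡ᵇ-refl zero    = refl
    ≡ᵇ-refl (suc a) = ≡ᵇ-refl a

    spokes : List (Fin n)
    spokes = x ∷ x′ ∷ y ∷ y′ ∷ heads R

    SpiderArc : Fin n → Fin n → Set
    SpiderArc u v = (u , v) ∈ spiderArcs (c , p) (x , y) (x′ , y′) R

    spoke : ∀ {v} → v ∈ spokes → SpiderArc c v
    spoke = ∈-++⁺ʳ M ∘ ∈-map⁺ (c ,_)

    core-spoke : ∀ i → SpiderArc c (coreVertex (suc i))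
    core-spoke zero                         = spoke (here refl)
    core-spoke (suc zero)                   = spoke (there (there (here refl)))
    core-spoke (suc (suc zero))             = spoke (there (here refl))
    core-spoke (suc (suc (suc zero)))       = spoke (there (there (there (here refl))))
    core-spoke (suc (suc (suc (suc zero)))) = here refl

    -- The numbers `a` and `b` are kept apart from `u` and `v` so that matching on positions can
    -- refine them. The pair 0, 0 and the source 2 have no clause because `B1arcℕ` evaluates to
    -- `false` there.
    B1⇒spider : ∀ {a b} → Position k a → Position k b → B1arcℕ a b ≡ true →
                ∀ {u v} → toℕ u ≡ a → toℕ v ≡ b → SpiderArc u v
    B1⇒spider (core zero) (core (suc i)) _ eu ev =
      subst₂ SpiderArc (sym (is-core (# 0) eu)) (sym (is-core (suc i) ev)) (core-spoke i)
    B1⇒spider (core zero) (even i) _ eu ev =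
      subst₂ SpiderArc (sym (is-core (# 0) eu)) (sym (is-even i ev)) (spoke (there (there (there (there (even∈heads i))))))
    B1⇒spider (core zero) (odd i) arc _ _ with trans (sym arc) (arc-to-odd i)
    ... | ()
    B1⇒spider {b = b} (core (suc zero)) _ arc eu ev =
      subst₂ SpiderArc (sym (is-core (# 1) eu)) (sym (is-core (# 2) (trans ev b≡2))) (there (here refl))
      where
      b≡2 : b ≡ 2
      b≡2 = ≡ᵇ-true⇒≡ b 2 (trans (sym (Bool.∨-identityʳ _)) arc)
    B1⇒spider {b = b} (core (suc (suc (suc zero)))) _ arc eu ev =
      subst₂ SpiderArc (sym (is-core (# 3) eu)) (sym (is-core (# 4) (trans ev b≡4))) (there (there (here refl)))
      where
      b≡4 : b ≡ 4
      b≡4 = ≡ᵇ-true⇒≡ b 4 (trans (sym (Bool.∨-identityʳ _)) arc)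
    B1⇒spider (core (suc (suc (suc (suc zero))))) _ ()
    B1⇒spider (core (suc (suc (suc (suc (suc zero)))))) _ ()
    B1⇒spider {b = b} (even i) _ arc _ _ with trans (sym arc) (arc-from-even i b)
    ... | ()
    B1⇒spider {b = b} (odd i) _ arc eu ev =
      subst₂ SpiderArc (sym (is-odd i eu)) (sym (is-even i (trans ev b≡)))
        (there (there (there (∈-++⁺ˡ (∈-map⁺ _ (∈-allFin i))))))
      where
      b≡ : b ≡ 6 + toℕ i * 2
      b≡ = ≡ᵇ-true⇒≡ b _ (trans (sym (arc-from-odd i b)) arc)

    B1-at : ∀ a b {u v : Fin n} → toℕ u ≡ a → toℕ v ≡ b → B1arcℕ a b ≡ true → B1 m u v ≡ true
    B1-at _ _ refl refl arc = arc

    spoke⇒B1 : ∀ {v} → v ∈ spokes → B1 m c v ≡ true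
    spoke⇒B1 (here refl)                         = B1-at 0 1 (toℕ-core (# 0)) (toℕ-core (# 1)) refl
    spoke⇒B1 (there (here refl))                 = B1-at 0 3 (toℕ-core (# 0)) (toℕ-core (# 3)) refl
    spoke⇒B1 (there (there (here refl)))         = B1-at 0 2 (toℕ-core (# 0)) (toℕ-core (# 2)) refl
    spoke⇒B1 (there (there (there (here refl)))) = B1-at 0 4 (toℕ-core (# 0)) (toℕ-core (# 4)) refl
    spoke⇒B1 (there (there (there (there v∈)))) with ∈-map⁻ proj₂ v∈
    ... | e , e∈ , refl with ∈-map⁻ _ e∈
    ...   | i , _ , refl = B1-at 0 (6 + toℕ i * 2) (toℕ-core (# 0)) (toℕ-even i) (arc-to-even i)

    M⇒B1 : ∀ {u v} → (u , v) ∈ M → B1 m u v ≡ true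
    M⇒B1 (here refl)                 = B1-at 0 5 (toℕ-core (# 0)) (toℕ-core (# 5)) refl
    M⇒B1 (there (here refl))         = B1-at 1 2 (toℕ-core (# 1)) (toℕ-core (# 2)) refl
    M⇒B1 (there (there (here refl))) = B1-at 3 4 (toℕ-core (# 3)) (toℕ-core (# 4)) refl
    M⇒B1 (there (there (there e∈))) with ∈-map⁻ _ e∈
    ... | i , _ , refl = B1-at (7 + toℕ i * 2) (6 + toℕ i * 2) (toℕ-odd i) (toℕ-even i)
      (trans (arc-from-odd i (6 + toℕ i * 2)) (≡ᵇ-refl (6 + toℕ i * 2)))

  B1-spider : Spider (3 + k) (B1 (3 + k))
  B1-spider = record
    { e₀ = c , p ; e₁ = x , y ; e₂ = x′ , y′ ; R = R
    ; ends-unique = M-ends-unique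
    ; length-M = |M|
    ; arc⇒ = λ {u} {v} arc → B1⇒spider (pos u) (pos v) arc refl refl
    ; arc⇐ = λ i → Sum.[ M⇒B1 , (λ j → let (v , v∈ , eq) = ∈-map⁻ (c ,_) j in
        trans (cong₂ (B1 m) (cong proj₁ eq) (cong proj₂ eq)) (spoke⇒B1 v∈)) ]′ (∈-++⁻ M i) }

spider⇒≅B1 : ∀ {m} → 3 ≤ m → {D : Digraph (2 * m)} → Spider m D → D ≅ B1 m
spider⇒≅B1 (s≤s (s≤s (s≤s {n = k} z≤n))) spider = spiders-isomorphic spider (B1-spider k)

≅B1⇒spider : ∀ {m} → 3 ≤ m → {D : Digraph (2 * m)} → D ≅ B1 m → Spider m D
≅B1⇒spider (s≤s (s≤s (s≤s {n = k} z≤n))) iso = spider-≅-resp iso (B1-spider k)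

theorem1 : (m : ℕ) → 3 ≤ m → (G : Graph (2 * m)) → Bicyclic G → MatchingNumber G m →
    (D : Digraph (2 * m)) → IsOrientation G D →
    (twiceM₁ D ≤ m * m + 9 * m + 2)
    × (twiceM₁ D ≡ m * m + 9 * m + 2 ⇔ (D ≅ B1 m ⊎ D ≅ B2 m))
theorem1 m 3≤m G (_ , |E|) ((K , (K-edges , K-unique) , |K|) , _) D or = bound , mk⇔ extremal attained
  where
  M : List (Arc (2 * m))
  M = map (orient D) K

  M⊆arcs : ∀ {e} → e ∈ M → e ∈ arcs D
  M⊆arcs e∈ with ∈-map⁻ (orient D) e∈
  ... | (u , v) , uv∈ , refl = orient-arc D G or (All.lookup K-edges uv∈)

  S : Split m D M
  S = mkSplit M (orientation-loopless G D or) (trans (length-arcs G D or) |E|)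
        (Unique-resp-↭ (endpoints-orient D K) K-unique) (trans (length-map (orient D) K) |K|) M⊆arcs

  open Split S using (N; twiceM₁-defect)

  maximum : ℕ
  maximum = m * m + 9 * m + 2

  m²+9m+6≡ : m * m + 9 * m + 6 ≡ maximum + 4
  m²+9m+6≡ = sym (+-assoc (m * m + 9 * m) 2 4)

  cases : twiceM₁ D < maximum ⊎ (twiceM₁ D ≡ maximum × (Spider m D ⊎ Spider m (flip D)))
  cases with defect-cases S 3≤m
  -- The value `maximum` corresponds to defect 4, so strictness needs only 5 of the 6.
  ... | inj₁ 6≤d = inj₁ (+-cancelʳ-≤ 4 _ _ (begin
    suc (twiceM₁ D) + 4                          ≡⟨ +-suc (twiceM₁ D) 4 ⟨
    twiceM₁ D + 5                                ≤⟨ +-monoʳ-≤ (twiceM₁ D) (≤-trans (n≤1+n 5) 6≤d) ⟩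
    twiceM₁ D + (2 * misfit M N + conflict N)    ≡⟨ twiceM₁-defect ⟩
    m * m + 9 * m + 6                            ≡⟨ m²+9m+6≡ ⟩
    maximum + 4                                   ∎))
    where open ≤-Reasoning
  ... | inj₂ (d≡4 , spider) = inj₂ (+-cancelʳ-≡ 4 _ _
    (trans (cong (twiceM₁ D +_) (sym d≡4)) (trans twiceM₁-defect m²+9m+6≡)) , spider)

  bound : twiceM₁ D ≤ maximum
  bound = Sum.[ <⇒≤ , ≤-reflexive ∘ proj₁ ]′ cases

  extremal : twiceM₁ D ≡ maximum → D ≅ B1 m ⊎ D ≅ B2 m
  extremal eq with cases
  ... | inj₁ lt              = ⊥-elim (<⇒≢ lt eq)
  ... | inj₂ (_ , inj₁ s)    = inj₁ (spider⇒≅B1 3≤m s)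
  -- `B2 m` is `B1 m` with its arguments exchanged, so an isomorphism from the reversal of `D` onto
  -- `B1 m` is one from `D` onto `B2 m`.
  ... | inj₂ (_ , inj₂ s)    = let (f , eq) = spider⇒≅B1 3≤m s in inj₂ (f , λ u v → eq v u)

  attains : ∀ E → IsOrientation G E → E ≅ B1 m → maximum ≤ twiceM₁ E
  attains E or iso = +-cancelʳ-≤ 4 _ _ (≤-trans (≤-reflexive (sym m²+9m+6≡))
    (spider-defect (orientation-loopless G E or) (trans (length-arcs G E or) |E|) (≅B1⇒spider 3≤m iso)))

  attained : D ≅ B1 m ⊎ D ≅ B2 m → twiceM₁ D ≡ maximum
  attained (inj₁ iso)      = ≤-antisym bound (attains D or iso)
  attained (inj₂ (f , eq)) = ≤-antisym bound
    (≤-trans (attains (flip D) (flip-orientation G D or) (f , λ u v → eq v u)) (≤-reflexive (twiceM₁-flip D)))
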